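{- For any integer $n\geq 1$, we have \[ |\mathsf{BP}_n^\star| = \sum_{i=1}^{p(n)} \frac{n!}{\prod_{j=1}^{d(i)} \left(m(i,j)!\right)^j}\cdot\frac{1}{\mathrm{lcm}(i)}, \] where $\mathrm{lcm}(i)=\mathrm{lcm}(\{j\in\{1,\dots,d(i)\}\mid m(i,j)\geq 1\})$ is the least common multiple of the part sizes occurring in the $i$-th integer partition of $n$.
   Context: Notation: $\llbracket n\rrbracket=\{0,\dots,n-1\}$. A partitioned order of $\llbracket n\rrbracket$ is an (unordered) set $\{S_k\}_{k\in\llbracket s\rrbracket}$ of $s$ sequences $S_k=(i^k_0,\dots,i^k_{n_k-1})$ with $n_k>0$, each consisting of pairwise distinct elements of $\llbracket n\rrbracket$, the sequences being pairwise disjoint (as sets of entries) with union $\llbracket n\rrbracket$; so every element of $\llbracket n\rrbracket$ occurs at exactly one position of exactly one sequence. A block-parallel update mode of size $n$ is a partitioned order of $\llbracket n\rrbracket$; its sequences are called o-blocks. The set of all of them is $\mathsf{BP}_n$. For $\mu=\{S_k\}_{k\in\llbracket s\rrbracket}\in\mathsf{BP}_n$, let $p=\mathrm{lcm}(n_0,\dots,n_{s-1})$ and define the sequence of blocks $\varphi(\mu)=(W_\ell)_{\ell\in\llbracket p\rrbracket}$ by $W_\ell=\{i^k_{\ell \bmod n_k}\mid k\in\llbracket s\rrbracket\}$; write $|\varphi(\mu)|=p$ for its length. Equivalence: $\sigma^i$ denotes the circular shift of order $i\in\mathbb{Z}$ on finite sequences, moving the element at position $0$ to position $i$ (positions modulo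 the length). For $\mu,\mu'\in\mathsf{BP}_n$, $\mu\equiv_\star\mu'$ means $\varphi(\mu)=\sigma^i(\varphi(\mu'))$ for some $i\in\llbracket|\varphi(\mu')|\rrbracket$. $\mathsf{BP}_n^\star=\mathsf{BP}_n/\equiv_\star$ is the quotient set. Integer partitions: $p(n)$ is the number of integer partitions of $n$ (multisets of positive integers summing to $n$), listed in some fixed order as partitions number $1,\dots,p(n)$; $d(i)$ is the maximal part size of the $i$-th partition, and $m(i,j)$ is the multiplicity of the part of size $j$ in the $i$-th partition (possibly $0$). -}

module Defs where

open import Data.Fin.Base as Fin using (Fin; zero; suc; toℕ; fromℕ<)
open import Data.Fin.Properties using (nonZeroIndex; toℕ-fromℕ<; toℕ<n; toℕ-injective)
open import Data.Fin.Subset using (Subset; ⁅_⁆; ⋃)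
open import Data.Fin.Subset.Properties using (∪-assoc; ∪-comm)
open import Data.Integer.Base as ℤ using (ℤ; +_; -_; 0ℤ)
import Data.Integer.Properties as ℤ
open import Data.Integer.DivMod using (_%ℕ_; _/ℕ_; n%ℕd<d; a≡a%ℕn+[a/ℕn]*n)
open import Data.Integer.Tactic.RingSolver using (solve-∀)
open import Data.List.Base as List using (List; []; _∷_; filter; upTo)
open import Data.List.NonEmpty.Base using (List⁺; length; toList)
open import Data.List.Properties using (≡-dec)
open import Data.List.Membership.Propositional using (_∈_)
import Data.List.Membership.Propositional.Properties as ∈
import Data.List.Membership.Setoid.Properties as ∈ₛ
open import Data.List.Relation.Binary.Disjoint.Propositional using (Disjoint)
open import Data.List.Relation.Binary.Permutation.Propositional
  using (_↭_; refl; prep; swap; trans; ↭-sym; ↭-trans; ↭-reflexive; ↭-setoid; ↭⇒↭ₛ)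
open import Data.List.Relation.Binary.Permutation.Propositional.Properties using (map⁺)
open import Data.List.Relation.Binary.Pointwise using (Pointwise-≡⇒≡)
open import Data.List.Relation.Unary.All as All using (All; []; _∷_)
import Data.List.Relation.Unary.All.Properties as All
open import Data.List.Relation.Unary.AllPairs using (AllPairs; []; _∷_)
open import Data.List.Relation.Unary.Any as Any using (Any; here; there)
open import Data.List.Relation.Unary.Any.Properties using (lookup-index; concatMap⁺)
open import Data.List.Relation.Unary.Sorted.TotalOrder.Properties using (↗↭↗⇒≋)
open import Data.List.Relation.Unary.Unique.Propositional using (Unique)
import Data.List.Relation.Unary.Unique.DecSetoid.Properties as UniqueDec
import Data.List.Relation.Unary.Unique.Setoid as Uniqueₛ
open import Data.List.Sort.InsertionSort.Base using (sort)
open import Data.List.Sort.InsertionSort.Properties using (sort-↗; sort-↭)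
open import Data.Nat.Base as ℕ using (ℕ; zero; suc; NonZero; _*_; _^_; _!; _⊔_)
open import Data.Nat.Divisibility using (_∣_; ∣⇒≤; divides; ∣-antisym; ∣-trans)
open import Data.Nat.DivMod using (_mod_)
open import Data.Nat.GCD using (gcd)
open import Data.Nat.LCM using (lcm; m∣lcm[m,n]; n∣lcm[m,n]; lcm-least; gcd*lcm)
open import Data.Nat.ListAction using (sum; product)
open import Data.Nat.ListAction.Properties using (product≢0)
import Data.Nat.Properties as ℕ
open import Data.Product.Base using (∃; Σ-syntax; _,_)
open import Data.Vec.Base as Vec using (Vec)
import Data.Vec.Properties as Vec
open import Function.Base using (_∘_; _on_)
open import Function.Bundles using (Inverse)
open import Level using (0ℓ)
open import Relation.Binary.Bundles using (Setoid; DecSetoid)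
import Relation.Binary.Construct.On as On
open import Relation.Binary.Definitions using (Decidable)
open import Relation.Binary.PropositionalEquality as ≡
  using (_≡_; refl; sym; cong; subst; module ≡-Reasoning)
open import Relation.Nullary using (contradiction)
import Relation.Nullary.Decidable as Dec

HasCardinality : Setoid 0ℓ 0ℓ → ℕ → Set
HasCardinality S c = Inverse (≡.setoid (Fin c)) S

lcms : List ℕ → ℕ
lcms = List.foldr lcm 1

lcm≢0 : ∀ m n → .{{NonZero m}} → .{{NonZero n}} → NonZero (lcm m n)
lcm≢0 m n = ℕ.m*n≢0⇒n≢0 (gcd m n) {{subst NonZero (sym (gcd*lcm m n)) (ℕ.m*n≢0 m n)}}

lcms≢0 : ∀ {ns} → All NonZero ns → NonZero (lcms ns)
lcms≢0 []                = _
lcms≢0 {n ∷ ns} (p ∷ ps) = lcm≢0 n (lcms ns) {{p}} {{lcms≢0 ps}}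

-- The set of sequences is encoded as a list, considered up to
-- permutation in the setoid BP below. No sequence is repeated in the
-- list, since distinct entries are disjoint and nonempty.
record PartitionedOrder (n : ℕ) : Set where
  field
    o-blocks : List (List⁺ (Fin n))
    distinct : All (Unique ∘ toList) o-blocks
    disjoint : AllPairs (Disjoint on toList) o-blocks
    covering : ∀ x → Any (λ S → x ∈ toList S) o-blocks

open PartitionedOrder public

BP : ℕ → Setoid 0ℓ 0ℓ
BP n = On.setoid (↭-setoid {A = List⁺ (Fin n)}) o-blocks

period : ∀ {n} → PartitionedOrder n → ℕ
period μ = lcms (List.map length (o-blocks μ))

cyclicLookup : ∀ {a} {A : Set a} → List⁺ A → ℕ → A
cyclicLookup S ℓ = List.lookup (toList S) (ℓ mod length S)

block : ∀ {n} → List (List⁺ (Fin n)) → ℕ → Subset n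
block Ss ℓ = ⋃ (List.map (λ S → ⁅ cyclicLookup S ℓ ⁆) Ss)

φ : ∀ {n} (μ : PartitionedOrder n) → Vec (Subset n) (period μ)
φ μ = Vec.tabulate λ ℓ → block (o-blocks μ) (toℕ ℓ)

index : ∀ p .{{_ : NonZero p}} → ℤ → Fin p
index p i = fromℕ< (n%ℕd<d i p)

-- The entry of σ i w at position ℓ is the entry of w at position ℓ - i,
-- so that the entry at position 0 of w moves to position i.
σ : ∀ {a} {A : Set a} {p} → ℤ → Vec A p → Vec A p
σ {p = p} i w = Vec.tabulate λ ℓ →
  Vec.lookup w (index p {{nonZeroIndex ℓ}} (+ toℕ ℓ ℤ.- i))

-- φ μ and φ μ′ may a priori have different lengths; equality of the
-- underlying lists includes equality of the lengths.
infix 4 _≡⋆_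
_≡⋆_ : ∀ {n} → PartitionedOrder n → PartitionedOrder n → Set
μ ≡⋆ μ′ = Σ[ i ∈ Fin (period μ′) ] Vec.toList (φ μ) ≡ Vec.toList (σ (+ toℕ i) (φ μ′))

+-injective-mod : ∀ {r s p} k → r ℕ.< p → s ℕ.< p → + r ≡ + s ℤ.+ k ℤ.* + p → r ≡ s
+-injective-mod {r} {s} {p} k r<p s<p eq = ℤ.+-injective (ℤ.i-j≡0⇒i≡j (+ r) (+ s) (ℤ.∣i∣≡0⇒i≡0 ∣r-s∣≡0))
  where
  r-s≡kp : + r ℤ.- + s ≡ k ℤ.* + p
  r-s≡kp = ≡.trans (cong (ℤ._- + s) eq) (cancel (+ s) (k ℤ.* + p))
    where
    cancel : ∀ a b → a ℤ.+ b ℤ.- a ≡ b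
    cancel = solve-∀

  small : ℤ.∣ + r ℤ.- + s ∣ ℕ.< p
  small = ℕ.≤-<-trans
    (subst (λ z → ℤ.∣ z ∣ ℕ.≤ r ⊔ s) (sym (ℤ.m-n≡m⊖n r s)) (ℤ.∣m⊝n∣≤m⊔n r s))
    (ℕ.⊔-lub r<p s<p)

  multiple : ℤ.∣ + r ℤ.- + s ∣ ≡ ℤ.∣ k ∣ * p
  multiple = ≡.trans (cong ℤ.∣_∣ r-s≡kp) (ℤ.abs-* k (+ p))

  ∣r-s∣≡0 : ℤ.∣ + r ℤ.- + s ∣ ≡ 0
  ∣r-s∣≡0 with ℤ.∣ + r ℤ.- + s ∣ | small | divides ℤ.∣ k ∣ multiple
  ... | zero  | _ | _   = refl
  ... | suc d | d<p | p∣d = contradiction d<p (ℕ.≤⇒≯ (∣⇒≤ p∣d))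

isolate : ∀ r q p → r ≡ (r ℤ.+ q ℤ.* p) ℤ.- q ℤ.* p
isolate = solve-∀

index-cong : ∀ p .{{_ : NonZero p}} {i j} k → i ≡ j ℤ.+ k ℤ.* + p → index p i ≡ index p j
index-cong p {i} {j} k eq = toℕ-injective (begin
  toℕ (index p i)  ≡⟨ toℕ-fromℕ< _ ⟩
  i %ℕ p           ≡⟨ +-injective-mod (j /ℕ p ℤ.+ k ℤ.- i /ℕ p) (n%ℕd<d i p) (n%ℕd<d j p) remainders ⟩
  j %ℕ p           ≡⟨ toℕ-fromℕ< _ ⟨
  toℕ (index p j)  ∎)
  where
  open ≡-Reasoning

  regroup : ∀ s q′ k q p → (s ℤ.+ q′ ℤ.* p ℤ.+ k ℤ.* p) ℤ.- q ℤ.* p ≡ s ℤ.+ (q′ ℤ.+ k ℤ.- q) ℤ.* p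
  regroup = solve-∀

  remainders : + (i %ℕ p) ≡ + (j %ℕ p) ℤ.+ (j /ℕ p ℤ.+ k ℤ.- i /ℕ p) ℤ.* + p
  remainders = begin
    + (i %ℕ p)
      ≡⟨ isolate _ (i /ℕ p) (+ p) ⟩
    (+ (i %ℕ p) ℤ.+ i /ℕ p ℤ.* + p) ℤ.- i /ℕ p ℤ.* + p
      ≡⟨ cong (ℤ._- i /ℕ p ℤ.* + p) (a≡a%ℕn+[a/ℕn]*n i p) ⟨
    i ℤ.- i /ℕ p ℤ.* + p
      ≡⟨ cong (ℤ._- i /ℕ p ℤ.* + p) eq ⟩
    (j ℤ.+ k ℤ.* + p) ℤ.- i /ℕ p ℤ.* + p
      ≡⟨ cong (λ x → (x ℤ.+ k ℤ.* + p) ℤ.- i /ℕ p ℤ.* + p) (a≡a%ℕn+[a/ℕn]*n j p) ⟩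
    (+ (j %ℕ p) ℤ.+ j /ℕ p ℤ.* + p ℤ.+ k ℤ.* + p) ℤ.- i /ℕ p ℤ.* + p
      ≡⟨ regroup (+ (j %ℕ p)) (j /ℕ p) k (i /ℕ p) (+ p) ⟩
    + (j %ℕ p) ℤ.+ (j /ℕ p ℤ.+ k ℤ.- i /ℕ p) ℤ.* + p ∎

toℕ-index : ∀ p .{{_ : NonZero p}} i → + toℕ (index p i) ≡ i ℤ.- (i /ℕ p) ℤ.* + p
toℕ-index p i = begin
  + toℕ (index p i)                                 ≡⟨ cong +_ (toℕ-fromℕ< _) ⟩
  + (i %ℕ p)                                        ≡⟨ isolate _ (i /ℕ p) (+ p) ⟩
  (+ (i %ℕ p) ℤ.+ i /ℕ p ℤ.* + p) ℤ.- i /ℕ p ℤ.* + p  ≡⟨ cong (ℤ._- i /ℕ p ℤ.* + p) (a≡a%ℕn+[a/ℕn]*n i p) ⟨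
  i ℤ.- i /ℕ p ℤ.* + p                              ∎
  where
  open ≡-Reasoning

index-toℕ : ∀ {p} .{{_ : NonZero p}} (ℓ : Fin p) → index p (+ toℕ ℓ) ≡ ℓ
index-toℕ {p} ℓ = toℕ-injective (≡.trans (toℕ-fromℕ< _)
  (+-injective-mod (- ((+ toℕ ℓ) /ℕ p)) (n%ℕd<d (+ toℕ ℓ) p) (toℕ<n ℓ)
    (≡.trans (≡.trans (cong +_ (sym (toℕ-fromℕ< (n%ℕd<d (+ toℕ ℓ) p)))) (toℕ-index p (+ toℕ ℓ)))
             (negate (+ toℕ ℓ) ((+ toℕ ℓ) /ℕ p) (+ p)))))
  where
  negate : ∀ a q p → a ℤ.- q ℤ.* p ≡ a ℤ.+ (- q) ℤ.* p
  negate = solve-∀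

module _ {a} {A : Set a} {p : ℕ} where

  σ-0 : (w : Vec A p) → σ 0ℤ w ≡ w
  σ-0 w = ≡.trans
    (Vec.tabulate-cong λ ℓ → cong (Vec.lookup w)
      (≡.trans (cong (index p {{nonZeroIndex ℓ}}) (ℤ.+-identityʳ (+ toℕ ℓ)))
               (index-toℕ {{nonZeroIndex ℓ}} ℓ)))
    (Vec.tabulate∘lookup w)

  σ-∘ : ∀ i j (w : Vec A p) → σ i (σ j w) ≡ σ (i ℤ.+ j) w
  σ-∘ i j w = Vec.tabulate-cong λ ℓ → let instance _ = nonZeroIndex ℓ in
    ≡.trans
      (Vec.lookup∘tabulate (λ k → Vec.lookup w (index p {{nonZeroIndex k}} (+ toℕ k ℤ.- j)))
                           (index p (+ toℕ ℓ ℤ.- i)))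
      (cong (Vec.lookup w) (shifted ℓ))
    where
    regroup : ∀ l i j q p → l ℤ.- i ℤ.- q ℤ.* p ℤ.- j ≡ l ℤ.- (i ℤ.+ j) ℤ.+ (- q) ℤ.* p
    regroup = solve-∀

    shifted : ∀ .{{_ : NonZero p}} (ℓ : Fin p) →
              index p (+ toℕ (index p (+ toℕ ℓ ℤ.- i)) ℤ.- j) ≡ index p (+ toℕ ℓ ℤ.- (i ℤ.+ j))
    shifted ℓ = index-cong p {j = + toℕ ℓ ℤ.- (i ℤ.+ j)} (- ((+ toℕ ℓ ℤ.- i) /ℕ p))
      (≡.trans (cong (ℤ._- j) (toℕ-index p (+ toℕ ℓ ℤ.- i)))
               (regroup (+ toℕ ℓ) i j ((+ toℕ ℓ ℤ.- i) /ℕ p) (+ p)))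

  σ-index : ∀ .{{_ : NonZero p}} i (w : Vec A p) → σ (+ toℕ (index p i)) w ≡ σ i w
  σ-index i w = Vec.tabulate-cong λ ℓ → cong (Vec.lookup w)
    (index-cong p {{nonZeroIndex ℓ}} {j = + toℕ ℓ ℤ.- i} (i /ℕ p)
      (≡.trans (cong (λ x → + toℕ ℓ ℤ.- x) (toℕ-index p i)) (regroup (+ toℕ ℓ) i (i /ℕ p) (+ p))))
    where
    regroup : ∀ l i q p → l ℤ.- (i ℤ.- q ℤ.* p) ≡ l ℤ.- i ℤ.+ q ℤ.* p
    regroup = solve-∀

toList-length : ∀ {a} {A : Set a} {p q} (v : Vec A p) (w : Vec A q) →
                Vec.toList v ≡ Vec.toList w → p ≡ q
toList-length v w eq =
  ≡.trans (sym (Vec.length-toList v)) (≡.trans (cong List.length eq) (Vec.length-toList w))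

σ-toList : ∀ {a} {A : Set a} {p q} i (v : Vec A p) (w : Vec A q) →
           Vec.toList v ≡ Vec.toList w → Vec.toList (σ i v) ≡ Vec.toList (σ i w)
σ-toList i v w eq with refl ← toList-length v w eq =
  cong (Vec.toList ∘ σ i) (≡.trans (sym (Vec.cast-is-id refl v)) (Vec.toList-injective refl v w eq))

period≢0 : ∀ {n} (μ : PartitionedOrder n) → NonZero (period μ)
period≢0 μ = lcms≢0 (All.map⁺ {xs = o-blocks μ} (All.tabulate λ _ → _))

module _ {n : ℕ} where

  shift : ∀ {μ μ′ : PartitionedOrder n} i →
          Vec.toList (φ μ) ≡ Vec.toList (σ i (φ μ′)) → μ ≡⋆ μ′
  shift {μ} {μ′} i eq = index (period μ′) {{period≢0 μ′}} i ,
    ≡.trans eq (cong Vec.toList (sym (σ-index {{period≢0 μ′}} i (φ μ′))))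

  ≡⋆-reflexive : ∀ {μ μ′ : PartitionedOrder n} → Vec.toList (φ μ) ≡ Vec.toList (φ μ′) → μ ≡⋆ μ′
  ≡⋆-reflexive {μ} {μ′} eq = shift {μ} {μ′} 0ℤ (≡.trans eq (cong Vec.toList (sym (σ-0 (φ μ′)))))

  ≡⋆-sym : ∀ {μ μ′ : PartitionedOrder n} → μ ≡⋆ μ′ → μ′ ≡⋆ μ
  ≡⋆-sym {μ} {μ′} (i , eq) = shift {μ′} {μ} (- (+ toℕ i)) (begin
    Vec.toList (φ μ′)                                ≡⟨ cong Vec.toList (σ-0 (φ μ′)) ⟨
    Vec.toList (σ 0ℤ (φ μ′))                         ≡⟨ cong (λ j → Vec.toList (σ j (φ μ′))) (ℤ.+-inverseˡ (+ toℕ i)) ⟨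
    Vec.toList (σ (- (+ toℕ i) ℤ.+ + toℕ i) (φ μ′))   ≡⟨ cong Vec.toList (σ-∘ (- (+ toℕ i)) (+ toℕ i) (φ μ′)) ⟨
    Vec.toList (σ (- (+ toℕ i)) (σ (+ toℕ i) (φ μ′))) ≡⟨ σ-toList (- (+ toℕ i)) (φ μ) (σ (+ toℕ i) (φ μ′)) eq ⟨
    Vec.toList (σ (- (+ toℕ i)) (φ μ))               ∎)
    where open ≡-Reasoning

  ≡⋆-trans : ∀ {μ μ′ μ″ : PartitionedOrder n} → μ ≡⋆ μ′ → μ′ ≡⋆ μ″ → μ ≡⋆ μ″
  ≡⋆-trans {μ} {μ′} {μ″} (i , eq) (j , eq′) = shift {μ} {μ″} (+ toℕ i ℤ.+ + toℕ j) (begin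
    Vec.toList (φ μ)                                ≡⟨ eq ⟩
    Vec.toList (σ (+ toℕ i) (φ μ′))                 ≡⟨ σ-toList (+ toℕ i) (φ μ′) (σ (+ toℕ j) (φ μ″)) eq′ ⟩
    Vec.toList (σ (+ toℕ i) (σ (+ toℕ j) (φ μ″)))   ≡⟨ cong Vec.toList (σ-∘ (+ toℕ i) (+ toℕ j) (φ μ″)) ⟩
    Vec.toList (σ (+ toℕ i ℤ.+ + toℕ j) (φ μ″))     ∎)
    where open ≡-Reasoning

  swap-inner : ∀ {a} {A : Set a} (_∙_ : A → A → A) →
               (∀ x y z → (x ∙ y) ∙ z ≡ x ∙ (y ∙ z)) → (∀ x y → x ∙ y ≡ y ∙ x) →
               ∀ x y z → x ∙ (y ∙ z) ≡ y ∙ (x ∙ z)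
  swap-inner _∙_ assoc comm x y z =
    ≡.trans (sym (assoc x y z)) (≡.trans (cong (_∙ z) (comm x y)) (assoc y x z))

  foldr-↭ : ∀ {a} {A : Set a} (_∙_ : A → A → A) e → (∀ x y z → x ∙ (y ∙ z) ≡ y ∙ (x ∙ z)) →
            ∀ {xs ys} → xs ↭ ys → List.foldr _∙_ e xs ≡ List.foldr _∙_ e ys
  foldr-↭ _∙_ e sw refl         = refl
  foldr-↭ _∙_ e sw (prep x p)   = cong (x ∙_) (foldr-↭ _∙_ e sw p)
  foldr-↭ _∙_ e sw (swap x y p) =
    ≡.trans (sw x y _) (cong (λ z → y ∙ (x ∙ z)) (foldr-↭ _∙_ e sw p))
  foldr-↭ _∙_ e sw (trans p q)  = ≡.trans (foldr-↭ _∙_ e sw p) (foldr-↭ _∙_ e sw q)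

  lcm-swap : ∀ x y z → lcm x (lcm y z) ≡ lcm y (lcm x z)
  lcm-swap x y z = ∣-antisym (half x y z) (half y x z)
    where
    half : ∀ x y z → lcm x (lcm y z) ∣ lcm y (lcm x z)
    half x y z = lcm-least
      (∣-trans (m∣lcm[m,n] x z) (n∣lcm[m,n] y (lcm x z)))
      (lcm-least (m∣lcm[m,n] y (lcm x z))
                 (∣-trans (n∣lcm[m,n] x z) (n∣lcm[m,n] y (lcm x z))))

  tabulate-toList : ∀ {a} {A : Set a} {p q} (f : ℕ → A) (g : ℕ → A) → p ≡ q → (∀ ℓ → f ℓ ≡ g ℓ) →
    Vec.toList (Vec.tabulate {n = p} (f ∘ toℕ)) ≡ Vec.toList (Vec.tabulate {n = q} (g ∘ toℕ))
  tabulate-toList f g refl f≗g = cong Vec.toList (Vec.tabulate-cong (f≗g ∘ toℕ))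

  ↭⇒≡⋆ : ∀ {μ μ′} → Setoid._≈_ (BP n) μ μ′ → μ ≡⋆ μ′
  ↭⇒≡⋆ {μ} {μ′} μ↭μ′ = ≡⋆-reflexive {μ} {μ′} (tabulate-toList (block (o-blocks μ)) (block (o-blocks μ′))
    (foldr-↭ lcm 1 lcm-swap (map⁺ length μ↭μ′))
    (λ ℓ → foldr-↭ _ _ (swap-inner _ ∪-assoc ∪-comm) (map⁺ (λ S → ⁅ cyclicLookup S ℓ ⁆) μ↭μ′)))

BP⋆ : ℕ → Setoid 0ℓ 0ℓ
BP⋆ n = record
  { Carrier       = Setoid.Carrier (BP n)
  ; _≈_           = _≡⋆_
  ; isEquivalence = record
    { refl  = λ {μ} → ≡⋆-reflexive {μ = μ} {μ} refl
    ; sym   = λ {μ} {μ′} → ≡⋆-sym {μ = μ} {μ′}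
    ; trans = λ {μ} {μ′} {μ″} → ≡⋆-trans {μ = μ} {μ′} {μ″}
    }
  }

-- The multiset of parts is encoded as a list, considered up to
-- permutation in the setoid IntegerPartitions below.
record IntegerPartition (n : ℕ) : Set where
  field
    parts    : List ℕ
    positive : All NonZero parts
    total    : sum parts ≡ n

open IntegerPartition public

IntegerPartitions : ℕ → Setoid 0ℓ 0ℓ
IntegerPartitions n = On.setoid (↭-setoid {A = ℕ}) (parts {n})

module _ {n : ℕ} (π : IntegerPartition n) where

  maxPart : ℕ
  maxPart = List.foldr _⊔_ 0 (parts π)

  multiplicity : ℕ → ℕ
  multiplicity j = List.length (filter (j ℕ.≟_) (parts π))

  1⋯max : List ℕ
  1⋯max = List.map suc (upTo maxPart)

  ∏m!^j : ℕ
  ∏m!^j = product (List.map (λ j → (multiplicity j !) ^ j) 1⋯max)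

  lcmOfParts : ℕ
  lcmOfParts = lcms (filter (λ j → 1 ℕ.≤? multiplicity j) 1⋯max)

  ∏m!^j≢0 : NonZero ∏m!^j
  ∏m!^j≢0 = product≢0 (All.map⁺ (All.tabulate {xs = 1⋯max} λ {j} _ →
    ℕ.m^n≢0 (multiplicity j !) j {{ℕ._!≢0 (multiplicity j)}}))

  lcmOfParts≢0 : NonZero lcmOfParts
  lcmOfParts≢0 = lcms≢0 (All.filter⁺ (λ j → 1 ℕ.≤? multiplicity j) (All.map⁺ (All.tabulate {xs = upTo maxPart} λ _ → _)))

_↭?_ : Decidable (_↭_ {A = ℕ})
xs ↭? ys = Dec.map′ sound complete (≡-dec ℕ._≟_ (sort′ xs) (sort′ ys))
  where
  sort′ = sort ℕ.≤-decTotalOrder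
  sort↭ = sort-↭ ℕ.≤-decTotalOrder

  sound : sort′ xs ≡ sort′ ys → xs ↭ ys
  sound eq = ↭-trans (↭-sym (sort↭ xs)) (↭-trans (↭-reflexive eq) (sort↭ ys))

  complete : xs ↭ ys → sort′ xs ≡ sort′ ys
  complete p = Pointwise-≡⇒≡ (↗↭↗⇒≋ ℕ.≤-totalOrder
    (sort-↗ ℕ.≤-decTotalOrder xs) (sort-↗ ℕ.≤-decTotalOrder ys)
    (↭⇒↭ₛ (↭-trans (sort↭ xs) (↭-trans p (↭-sym (sort↭ ys))))))

module _ (S : DecSetoid 0ℓ 0ℓ) where
  open DecSetoid S renaming (Carrier to C; refl to ≈-refl; sym to ≈-sym; trans to ≈-trans)

  unique-lookup : ∀ {xs} → Uniqueₛ.Unique setoid xs → ∀ i j →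
                  List.lookup xs i ≈ List.lookup xs j → i ≡ j
  unique-lookup (_ ∷ _)   zero    zero    _  = refl
  unique-lookup (x≉ ∷ _)  zero    (suc j) eq = contradiction eq (All.lookup x≉ (∈.∈-lookup j))
  unique-lookup (x≉ ∷ _)  (suc i) zero    eq = contradiction (≈-sym eq) (All.lookup x≉ (∈.∈-lookup i))
  unique-lookup (_ ∷ xs!) (suc i) (suc j) eq = cong suc (unique-lookup xs! i j eq)

  cover⇒cardinality : ∀ xs → (∀ x → Any (x ≈_) xs) → ∃ (HasCardinality setoid)
  cover⇒cardinality xs ∈xs = List.length ys , record
    { to        = List.lookup ys
    ; from      = position
    ; to-cong   = λ { refl → ≈-refl }
    ; from-cong = λ {x} {y} x≈y → unique-lookup ys! _ _
        (≈-trans (≈-sym (found x)) (≈-trans x≈y (found y)))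
    ; inverse   = (λ { {x} refl → ≈-sym (found x) })
                , (λ {i} {y} y≈ → unique-lookup ys! _ _ (≈-trans (≈-sym (found y)) y≈))
    }
    where
    ys = List.deduplicate _≟_ xs
    ys! = UniqueDec.deduplicate-! S xs
    ∈ys : ∀ x → Any (x ≈_) ys
    ∈ys x = ∈ₛ.∈-deduplicate⁺ setoid _≟_ (λ z≈y x≈y → ≈-trans x≈y (≈-sym z≈y)) (∈xs x)
    position : C → Fin (List.length ys)
    position x = Any.index (∈ys x)
    found : ∀ x → x ≈ List.lookup ys (position x)
    found x = lookup-index (∈ys x)

increments : ∀ {n} → IntegerPartition n → List (IntegerPartition (suc n))
increments π@record { parts = [] } =
  record { parts = 1 ∷ parts π ; positive = _ ∷ positive π ; total = cong suc (total π) } ∷ []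
increments π@record { parts = k ∷ ks ; positive = _ ∷ ks≢0 } =
  record { parts = 1 ∷ parts π ; positive = _ ∷ positive π ; total = cong suc (total π) } ∷
  record { parts = suc k ∷ ks ; positive = _ ∷ ks≢0 ; total = cong suc (total π) } ∷ []

compositions : ∀ n → List (IntegerPartition n)
compositions zero    = record { parts = [] ; positive = [] ; total = refl } ∷ []
compositions (suc n) = List.concatMap increments (compositions n)

compositions-complete : ∀ {n} (π : IntegerPartition n) →
                        Any (λ π′ → parts π ≡ parts π′) (compositions n)
compositions-complete {zero} record { parts = [] } = here refl
compositions-complete {_} record { parts = zero ∷ _ ; positive = record { nonZero = () } ∷ _ }
compositions-complete {zero} record { parts = suc _ ∷ _ ; total = () }
compositions-complete {suc n} record { parts = suc zero ∷ ks ; positive = _ ∷ ks≢0 ; total = eq } =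
  concatMap⁺ increments (Any.map (λ {ρ} → prepended ρ)
    (compositions-complete record { parts = ks ; positive = ks≢0 ; total = ℕ.suc-injective eq }))
  where
  prepended : ∀ ρ → ks ≡ parts ρ → Any (λ π′ → 1 ∷ ks ≡ parts π′) (increments ρ)
  prepended record { parts = [] }                        eq = here (cong (1 ∷_) eq)
  prepended record { parts = _ ∷ _ ; positive = _ ∷ _ } eq = here (cong (1 ∷_) eq)
compositions-complete {suc n} record { parts = suc (suc k) ∷ ks ; positive = _ ∷ ks≢0 ; total = eq } =
  concatMap⁺ increments (Any.map (λ {ρ} → incremented ρ)
    (compositions-complete record { parts = suc k ∷ ks ; positive = _ ∷ ks≢0 ; total = ℕ.suc-injective eq }))
  where
  incremented : ∀ ρ → suc k ∷ ks ≡ parts ρ → Any (λ π′ → suc (suc k) ∷ ks ≡ parts π′) (increments ρ)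
  incremented record { parts = _ ∷ _ ; positive = _ ∷ _ } refl = there (here refl)

enumeration : ∀ n → ∃ (HasCardinality (IntegerPartitions n))
enumeration n = cover⇒cardinality S (compositions n)
  (λ π → Any.map ↭-reflexive (compositions-complete π))
  where
  S : DecSetoid 0ℓ 0ℓ
  S = record
    { Carrier = IntegerPartition n
    ; isDecEquivalence = record
      { isEquivalence = Setoid.isEquivalence (IntegerPartitions n)
      ; _≟_           = λ π π′ → parts π ↭? parts π′
      }
    }

{-# OPTIONS --safe #-}

-- The indices ℓ with x ∈ W_ℓ form the residue class of the position of x in its
-- o-block modulo the size of that o-block, so φ(μ) amounts to the colouring
-- x ↦ (size, position), and σ^i adds i to all positions. Two such shifts of φ(μ)
-- agree only if they are congruent modulo every size, i.e. modulo lcm(i).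
-- Cut each of the n! permutations v of ⟦n⟧ into o-blocks whose sizes are the parts of
-- a fixed partition. The result is ≡⋆ to μ iff a shifted colouring of μ, read along v,
-- spells one fixed word; for each of the lcm(i) shifts this happens for ∏ m(i,j)!^j
-- permutations. Hence the number of classes of this type times lcm(i) ∏ m(i,j)!^j is n!.
module Submission where

open import Defs
open import Data.Integer.Base using (+_)
open import Data.Nat.Base using (ℕ; _≥_; _!)
open import Data.Product.Base using (∃; _×_)
open import Data.Rational.Base using (_/_; _*_)
open import Data.Rational.Properties using (+-0-commutativeMonoid)
open import Algebra.Properties.CommutativeMonoid.Sum +-0-commutativeMonoid using (sum-syntax; sum-cong-≗)
open import Function.Bundles using (Inverse)
open import Relation.Binary.PropositionalEquality using (_≡_)

import Algebra.Properties.CommutativeSemigroup as CommutativeSemigroup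
open import Data.Bool.Base using (true; false; if_then_else_)
import Data.Bool.Properties as Bool
open import Data.Fin.Base using (Fin; zero; suc; toℕ)
import Data.Fin.Properties as Fin
import Data.Fin.Subset as Subset
import Data.Fin.Subset.Properties as Subset
import Data.Integer.Base as ℤ
open import Data.Integer.DivMod using (_/ℕ_)
import Data.Integer.Properties as ℤ
open import Data.Integer.Tactic.RingSolver using (solve-∀)
open import Data.List.Base as List using (List; []; _∷_; _++_; map; concatMap; filter; upTo; allFin)
open import Data.List.Membership.Propositional using (_∈_; find; lose)
import Data.List.Membership.Propositional.Properties as ∈
open import Data.List.Membership.Propositional.Properties.WithK using (unique∧set⇒bag)
open import Data.List.NonEmpty.Base as List⁺ using (List⁺; length; toList)
import Data.List.Properties as List
open import Data.List.Relation.Binary.BagAndSetEquality using (∼bag⇒↭)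
open import Data.List.Relation.Binary.Disjoint.Propositional using (Disjoint)
open import Data.List.Relation.Binary.Permutation.Propositional
  using (_↭_; ↭-refl; ↭-sym; ↭-trans; ↭-reflexive; refl; prep; swap; trans; ↭⇒↭ₛ)
import Data.List.Relation.Binary.Permutation.Propositional.Properties as ↭
import Data.List.Relation.Binary.Permutation.Setoid.Properties as ↭ₛ
open import Data.List.Relation.Unary.All as All using (All; []; _∷_)
import Data.List.Relation.Unary.All.Properties as All
open import Data.List.Relation.Unary.AllPairs using (AllPairs; []; _∷_)
import Data.List.Relation.Unary.AllPairs.Properties as AllPairs
open import Data.List.Relation.Unary.Any as Any using (Any; here; there)
import Data.List.Relation.Unary.Any.Properties as Any
open import Data.List.Relation.Unary.Unique.Propositional using (Unique)
import Data.List.Relation.Unary.Unique.Propositional.Properties as Unique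
open import Data.Nat.Base as ℕ
  using (zero; suc; _+_; _∸_; _^_; _⊔_; _≤_; _<_; NonZero; ≢-nonZero⁻¹; ∣_-_∣)
open import Data.Nat.Divisibility using (_∣_; divides; 1∣_; ∣⇒≤; ∣-antisym; ∣-trans)
open import Data.Nat.DivMod hiding (_/_)
open import Data.Nat.LCM using (lcm; lcm-least; m∣lcm[m,n]; n∣lcm[m,n])
open import Data.Nat.ListAction using (sum; product)
import Data.Nat.ListAction.Properties as ListAction
import Data.Nat.Properties as ℕ
open import Data.Product.Base using (Σ; _,_; proj₁; proj₂)
import Data.Product.Properties as Product
import Data.Rational.Base as ℚ
import Data.Rational.Properties as ℚ
import Data.Rational.Unnormalised.Base as ℚᵘ
import Data.Rational.Unnormalised.Properties as ℚᵘ
open import Data.Sum.Base using (inj₁; inj₂)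
import Data.Vec.Base as Vec
import Data.Vec.Properties as Vec
open import Function.Base using (_∘_; _on_; _∋_; id)
open import Function.Bundles using (_⇔_; mk⇔; module Equivalence)
open import Relation.Binary.Bundles using (Setoid; DecSetoid)
open import Relation.Binary.Definitions using (DecidableEquality)
open import Relation.Binary.PropositionalEquality
  using (_≢_; refl; sym; cong; cong₂; subst; setoid; module ≡-Reasoning)
  renaming (trans to ≡-trans)
open import Relation.Nullary using (Dec; ¬_; yes; no; does; contradiction)
open import Relation.Nullary.Decidable using (does-⇔; dec-true; dec-false)

open Equivalence using (to; from)

-- The exponent `j` in the denominator reflects that `φ` is not injective: exchanging the entries at
-- one position of two o-blocks of equal size leaves every W_ℓ unchanged. So at each of the j
-- positions, the m(i,j) o-blocks of size j may permute their entries independently, which gives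
-- m(i,j)!^j. Counting update modes directly would mean dividing by these exchanges and separately
-- by the reorderings of o-blocks in the list; counting permutations v with repetition absorbs both.
-- The classes are not enumerated by canonical forms either. Finitely many arrangements meet every
-- class and `≡⋆` is decidable, so some cardinality c exists; double counting of pairs (class,
-- arrangement) then determines it. All of this happens in ℕ as an identity of products, and
-- division enters only at the end.

private
  module +-CS = CommutativeSemigroup ℕ.+-commutativeSemigroup
  module *-CS = CommutativeSemigroup ℕ.*-commutativeSemigroup

  variable
    A B : Set

-- Indicators and sums over lists

-- Counts are written as sums of indicators, so that double counting becomes the exchange of sums
-- `∑ₗ-comm`. Only the Boolean of the decision enters, hence equivalent propositions have equal
-- indicators whatever their decision procedures.
𝟙 : Dec A → ℕ
𝟙 a? = if does a? then 1 else 0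

𝟙-cong : A ⇔ B → (a? : Dec A) (b? : Dec B) → 𝟙 a? ≡ 𝟙 b?
𝟙-cong A⇔B a? b? = cong (if_then 1 else 0) (does-⇔ A⇔B a? b?)

𝟙-yes : (a? : Dec A) → A → 𝟙 a? ≡ 1
𝟙-yes a? a = cong (if_then 1 else 0) (dec-true a? a)

𝟙-no : (a? : Dec A) → ¬ A → 𝟙 a? ≡ 0
𝟙-no a? ¬a = cong (if_then 1 else 0) (dec-false a? ¬a)

∑ₗ : List A → (A → ℕ) → ℕ
∑ₗ xs f = sum (map f xs)

∑ₗ-cong : ∀ {f g : A → ℕ} (xs : List A) → All (λ x → f x ≡ g x) xs → ∑ₗ xs f ≡ ∑ₗ xs g
∑ₗ-cong []       []         = refl
∑ₗ-cong (_ ∷ xs) (eq ∷ eqs) = cong₂ _+_ eq (∑ₗ-cong xs eqs)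

∑ₗ-const : ∀ (xs : List A) c → ∑ₗ xs (λ _ → c) ≡ List.length xs ℕ.* c
∑ₗ-const []       c = refl
∑ₗ-const (_ ∷ xs) c = cong₂ _+_ refl (∑ₗ-const xs c)

∑ₗ-1 : ∀ (xs : List A) → ∑ₗ xs (λ _ → 1) ≡ List.length xs
∑ₗ-1 xs = ≡-trans (∑ₗ-const xs 1) (ℕ.*-identityʳ _)

∑ₗ-++ : ∀ (f : A → ℕ) xs ys → ∑ₗ (xs ++ ys) f ≡ ∑ₗ xs f + ∑ₗ ys f
∑ₗ-++ f xs ys = ≡-trans (cong sum (List.map-++ f xs ys)) (ListAction.sum-++ (map f xs) (map f ys))

∑ₗ-map : ∀ (f : B → ℕ) (g : A → B) xs → ∑ₗ (map g xs) f ≡ ∑ₗ xs (f ∘ g)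
∑ₗ-map f g xs = cong sum (sym (List.map-∘ xs))

∑ₗ-concatMap : ∀ (f : B → ℕ) (g : A → List B) xs → ∑ₗ (concatMap g xs) f ≡ ∑ₗ xs (λ x → ∑ₗ (g x) f)
∑ₗ-concatMap f g []       = refl
∑ₗ-concatMap f g (x ∷ xs) =
  ≡-trans (∑ₗ-++ f (g x) (concatMap g xs)) (cong₂ _+_ refl (∑ₗ-concatMap f g xs))

∑ₗ-+ : ∀ (f g : A → ℕ) xs → ∑ₗ xs (λ x → f x + g x) ≡ ∑ₗ xs f + ∑ₗ xs g
∑ₗ-+ f g []       = refl
∑ₗ-+ f g (x ∷ xs) = ≡-trans (cong₂ _+_ refl (∑ₗ-+ f g xs)) (+-CS.interchange (f x) (g x) _ _)

∑ₗ-comm : ∀ (f : A → B → ℕ) xs ys → ∑ₗ xs (λ x → ∑ₗ ys (f x)) ≡ ∑ₗ ys (λ y → ∑ₗ xs (λ x → f x y))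
∑ₗ-comm f []       ys = sym (≡-trans (∑ₗ-const ys 0) (ℕ.*-zeroʳ (List.length ys)))
∑ₗ-comm f (x ∷ xs) ys =
  ≡-trans (cong₂ _+_ refl (∑ₗ-comm f xs ys)) (sym (∑ₗ-+ (f x) _ ys))

∑ₗ-↭ : ∀ (f : A → ℕ) {xs ys} → xs ↭ ys → ∑ₗ xs f ≡ ∑ₗ ys f
∑ₗ-↭ f p = ListAction.sum-↭ (↭.map⁺ f p)

∑ₗ-* : ∀ (f : A → ℕ) c xs → ∑ₗ xs (λ x → f x ℕ.* c) ≡ ∑ₗ xs f ℕ.* c
∑ₗ-* f c []       = refl
∑ₗ-* f c (x ∷ xs) = ≡-trans (cong₂ _+_ refl (∑ₗ-* f c xs)) (sym (ℕ.*-distribʳ-+ c (f x) (∑ₗ xs f)))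

-- Discards the proofs that `All.toList` attaches to the entries once the summand no longer refers
-- to them.
∑ₗ-toList : ∀ {P : A → Set} (f : A → ℕ) {xs} (pxs : All P xs) → ∑ₗ (All.toList pxs) (f ∘ proj₁) ≡ ∑ₗ xs f
∑ₗ-toList f []         = refl
∑ₗ-toList f (px ∷ pxs) = cong₂ _+_ refl (∑ₗ-toList f pxs)

∑ₗ-𝟙-none : ∀ {P : A → Set} (P? : ∀ x → Dec (P x)) xs → All (¬_ ∘ P) xs → ∑ₗ xs (𝟙 ∘ P?) ≡ 0
∑ₗ-𝟙-none P? []       []          = refl
∑ₗ-𝟙-none P? (x ∷ xs) (¬px ∷ ¬ps) = cong₂ _+_ (𝟙-no (P? x) ¬px) (∑ₗ-𝟙-none P? xs ¬ps)

-- Extracts existence from a count: a class is shown to contain an arrangement because the number of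
-- such arrangements is not zero.
∑ₗ-𝟙-any : ∀ {P : A → Set} (P? : ∀ x → Dec (P x)) xs → ∑ₗ xs (𝟙 ∘ P?) ≢ 0 → Any P xs
∑ₗ-𝟙-any P? xs ≢0 with Any.any? P? xs
... | yes p = p
... | no ¬p = contradiction (∑ₗ-𝟙-none P? xs (All.¬Any⇒All¬ xs ¬p)) ≢0

-- Permutations of a list

insertions : A → List A → List (List A)
insertions x []       = (x ∷ []) ∷ []
insertions x (y ∷ ys) = (x ∷ y ∷ ys) ∷ map (y ∷_) (insertions x ys)

length-insertions : ∀ (x : A) ys → List.length (insertions x ys) ≡ suc (List.length ys)
length-insertions x []       = refl
length-insertions x (y ∷ ys) =
  cong suc (≡-trans (List.length-map (y ∷_) (insertions x ys)) (length-insertions x ys))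

insertions-↭ : ∀ (x : A) ys → All (_↭ x ∷ ys) (insertions x ys)
insertions-↭ x []       = ↭-refl ∷ []
insertions-↭ x (y ∷ ys) = ↭-refl ∷
  All.map⁺ (All.map (λ p → ↭-trans (prep y p) (swap y x ↭-refl)) (insertions-↭ x ys))

-- Entries are inserted at every position without being compared. A list of length n therefore
-- always has n! permutations, and equal lists occur repeatedly when entries repeat.
permutations : List A → List (List A)
permutations []       = [] ∷ []
permutations (x ∷ xs) = concatMap (insertions x) (permutations xs)

permutations-↭ : ∀ (xs : List A) → All (_↭ xs) (permutations xs)
permutations-↭ []       = ↭-refl ∷ []
permutations-↭ (x ∷ xs) = All.concat⁺ (All.map⁺ (All.map
  (λ {ys} ys↭xs → All.map (λ p → ↭-trans p (prep x ys↭xs)) (insertions-↭ x ys))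
  (permutations-↭ xs)))

length-permutations : ∀ (xs : List A) → List.length (permutations xs) ≡ List.length xs !
length-permutations []       = refl
length-permutations (x ∷ xs) = begin
  List.length (permutations (x ∷ xs))                      ≡⟨ ∑ₗ-1 (permutations (x ∷ xs)) ⟨
  ∑ₗ (concatMap (insertions x) (permutations xs)) (λ _ → 1) ≡⟨ ∑ₗ-concatMap _ (insertions x) (permutations xs) ⟩
  ∑ₗ (permutations xs) (λ ys → ∑ₗ (insertions x ys) (λ _ → 1))
    ≡⟨ ∑ₗ-cong (permutations xs) (All.map (λ {ys} p →
         ≡-trans (∑ₗ-1 (insertions x ys)) (≡-trans (length-insertions x ys) (cong suc (↭.↭-length p))))
         (permutations-↭ xs)) ⟩
  ∑ₗ (permutations xs) (λ _ → suc (List.length xs))       ≡⟨ ∑ₗ-const (permutations xs) _ ⟩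
  List.length (permutations xs) ℕ.* suc (List.length xs)  ≡⟨ cong (ℕ._* suc (List.length xs)) (length-permutations xs) ⟩
  List.length xs ! ℕ.* suc (List.length xs)               ≡⟨ ℕ.*-comm (List.length xs !) _ ⟩
  suc (List.length xs) !                                  ∎
  where open ≡-Reasoning

insertions-map : ∀ (f : A → B) x ys → insertions (f x) (map f ys) ≡ map (map f) (insertions x ys)
insertions-map f x []       = refl
insertions-map f x (y ∷ ys) = cong ((f x ∷ f y ∷ map f ys) ∷_) (begin
  map (f y ∷_) (insertions (f x) (map f ys))  ≡⟨ cong (map (f y ∷_)) (insertions-map f x ys) ⟩
  map (f y ∷_) (map (map f) (insertions x ys)) ≡⟨ List.map-∘ (insertions x ys) ⟨
  map (λ zs → f y ∷ map f zs) (insertions x ys) ≡⟨ List.map-∘ (insertions x ys) ⟩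
  map (map f) (map (y ∷_) (insertions x ys))  ∎)
  where open ≡-Reasoning

-- Holds because insertion never inspects the entries. It turns the orders whose colouring spells a
-- given word into the copies of that word among the permutations of a list of colours.
permutations-map : ∀ (f : A → B) xs → permutations (map f xs) ≡ map (map f) (permutations xs)
permutations-map f []       = refl
permutations-map f (x ∷ xs) = begin
  concatMap (insertions (f x)) (permutations (map f xs))    ≡⟨ cong (concatMap (insertions (f x))) (permutations-map f xs) ⟩
  concatMap (insertions (f x)) (map (map f) (permutations xs)) ≡⟨ List.concatMap-map _ (map f) (permutations xs) ⟩
  concatMap (insertions (f x) ∘ map f) (permutations xs)    ≡⟨ List.concatMap-cong (insertions-map f x) (permutations xs) ⟩
  concatMap (map (map f) ∘ insertions x) (permutations xs)  ≡⟨ List.map-concatMap (map f) (insertions x) (permutations xs) ⟨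
  map (map f) (concatMap (insertions x) (permutations xs))  ∎
  where open ≡-Reasoning

-- Copies of a list among the permutations of another

module Occurrences {A : Set} (_≟_ : DecidableEquality A) where

  infix 4 _≟ₗ_
  _≟ₗ_ : DecidableEquality (List A)
  _≟ₗ_ = List.≡-dec _≟_

  occ : A → List A → ℕ
  occ x ys = ∑ₗ ys (λ y → 𝟙 (x ≟ y))

  occₗ : List A → List (List A) → ℕ
  occₗ xs yss = ∑ₗ yss (λ ys → 𝟙 (xs ≟ₗ ys))

  occ-∷-≡ : ∀ x ys → occ x (x ∷ ys) ≡ suc (occ x ys)
  occ-∷-≡ x ys = cong (_+ occ x ys) (𝟙-yes (x ≟ x) refl)

  occ-∷-≢ : ∀ {x y} → x ≢ y → ∀ ys → occ x (y ∷ ys) ≡ occ x ys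
  occ-∷-≢ {x} {y} x≢y ys = cong (_+ occ x ys) (𝟙-no (x ≟ y) x≢y)

  removals : A → List A → List (List A)
  removals x []       = []
  removals x (y ∷ ys) with x ≟ y
  ... | yes _ = ys ∷ map (y ∷_) (removals x ys)
  ... | no  _ = map (y ∷_) (removals x ys)

  length-removals : ∀ x ys → List.length (removals x ys) ≡ occ x ys
  length-removals x []       = refl
  length-removals x (y ∷ ys) with x ≟ y
  ... | yes _ = cong suc (≡-trans (List.length-map (y ∷_) (removals x ys)) (length-removals x ys))
  ... | no  _ = ≡-trans (List.length-map (y ∷_) (removals x ys)) (length-removals x ys)

  removals-↭ : ∀ x ys → All (λ zs → x ∷ zs ↭ ys) (removals x ys)
  removals-↭ x []       = []
  removals-↭ x (y ∷ ys) with x ≟ y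
  ... | yes refl = ↭-refl ∷ All.map⁺ (All.map (λ p → ↭-trans (swap x y ↭-refl) (prep y p)) (removals-↭ x ys))
  ... | no  _    = All.map⁺ (All.map (λ p → ↭-trans (swap x y ↭-refl) (prep y p)) (removals-↭ x ys))

  occₗ-map-∷-≢ : ∀ {x y} → x ≢ y → ∀ xs yss → occₗ (x ∷ xs) (map (y ∷_) yss) ≡ 0
  occₗ-map-∷-≢ x≢y xs []         = refl
  occₗ-map-∷-≢ {x} {y} x≢y xs (ys ∷ yss) =
    cong₂ _+_ (𝟙-no (x ∷ xs ≟ₗ y ∷ ys) (λ { refl → x≢y refl })) (occₗ-map-∷-≢ x≢y xs yss)

  occₗ-map-∷-≡ : ∀ x xs yss → occₗ (x ∷ xs) (map (x ∷_) yss) ≡ occₗ xs yss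
  occₗ-map-∷-≡ x xs []         = refl
  occₗ-map-∷-≡ x xs (ys ∷ yss) =
    cong₂ _+_ (𝟙-cong (mk⇔ (λ { refl → refl }) (cong (x ∷_))) (x ∷ xs ≟ₗ x ∷ ys) (xs ≟ₗ ys))
              (occₗ-map-∷-≡ x xs yss)

  occₗ-[]-map-∷ : ∀ y yss → occₗ [] (map (y ∷_) yss) ≡ 0
  occₗ-[]-map-∷ y []         = refl
  occₗ-[]-map-∷ y (_ ∷ yss) = occₗ-[]-map-∷ y yss

  mutual

    -- Insertion and removal are adjoint: both sides count the positions of `ys` that hold `x` and
    -- whose deletion leaves `zs`.
    occₗ-insertions : ∀ x ys zs → occₗ ys (insertions x zs) ≡ occₗ zs (removals x ys)
    occₗ-insertions x []       []       = refl
    occₗ-insertions x []       (z ∷ zs) = occₗ-[]-map-∷ z (insertions x zs)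
    occₗ-insertions x (y ∷ ys) []       with x ≟ y
    ... | yes refl = cong₂ _+_
      (𝟙-cong (mk⇔ (λ { refl → refl }) (λ { refl → refl })) (y ∷ ys ≟ₗ x ∷ []) ([] ≟ₗ ys))
      (sym (occₗ-[]-map-∷ y (removals x ys)))
    ... | no x≢y = cong₂ _+_
      (𝟙-no (y ∷ ys ≟ₗ x ∷ []) (λ { refl → x≢y refl }))
      (sym (occₗ-[]-map-∷ y (removals x ys)))
    occₗ-insertions x (y ∷ ys) (z ∷ zs) with x ≟ y
    ... | yes refl = cong₂ _+_
      (𝟙-cong (mk⇔ (λ { refl → refl }) (λ { refl → refl })) (y ∷ ys ≟ₗ x ∷ z ∷ zs) (z ∷ zs ≟ₗ ys))
      (occₗ-insertions-∷ x y ys z zs)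
    ... | no x≢y = cong₂ _+_
      (𝟙-no (y ∷ ys ≟ₗ x ∷ z ∷ zs) (λ { refl → x≢y refl }))
      (occₗ-insertions-∷ x y ys z zs)

    -- The positions behind the head: the heads `y` and `z` survive on both sides, so both counts
    -- vanish unless they agree.
    occₗ-insertions-∷ : ∀ x y ys z zs →
      occₗ (y ∷ ys) (map (z ∷_) (insertions x zs)) ≡ occₗ (z ∷ zs) (map (y ∷_) (removals x ys))
    occₗ-insertions-∷ x y ys z zs with y ≟ z
    ... | yes refl = ≡-trans (occₗ-map-∷-≡ y ys (insertions x zs))
      (≡-trans (occₗ-insertions x ys zs) (sym (occₗ-map-∷-≡ y zs (removals x ys))))
    ... | no y≢z = ≡-trans (occₗ-map-∷-≢ y≢z ys (insertions x zs))
      (sym (occₗ-map-∷-≢ (y≢z ∘ sym) zs (removals x ys)))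

  -- The product of k! over the multiplicities k of the distinct entries.
  ∏occ! : List A → ℕ
  ∏occ! []       = 1
  ∏occ! (x ∷ xs) = suc (occ x xs) ℕ.* ∏occ! xs

  -- By adjunction, inserting `x` into permutations of `xs` becomes removing `x` from the target
  -- `ys`. There are `suc (occ x xs)` removals, and each leaves a permutation of `xs`, to which
  -- induction applies.
  occₗ-permutations : ∀ {xs ys} → ys ↭ xs → occₗ ys (permutations xs) ≡ ∏occ! xs
  occₗ-permutations {[]}     ys↭[] = cong (λ ys → occₗ ys ([] ∷ [])) (↭.↭-empty-inv ys↭[])
  occₗ-permutations {x ∷ xs} {ys} ys↭x∷xs = begin
    occₗ ys (concatMap (insertions x) (permutations xs))
      ≡⟨ ∑ₗ-concatMap _ (insertions x) (permutations xs) ⟩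
    ∑ₗ (permutations xs) (λ zs → occₗ ys (insertions x zs))
      ≡⟨ ∑ₗ-cong (permutations xs) (All.universal (occₗ-insertions x ys) _) ⟩
    ∑ₗ (permutations xs) (λ zs → occₗ zs (removals x ys))
      ≡⟨ ∑ₗ-comm _ (permutations xs) (removals x ys) ⟩
    ∑ₗ (removals x ys) (λ ws → ∑ₗ (permutations xs) (λ zs → 𝟙 (zs ≟ₗ ws)))
      ≡⟨ ∑ₗ-cong (removals x ys) (All.universal (λ ws → ∑ₗ-cong (permutations xs)
           (All.universal (λ zs → 𝟙-cong (mk⇔ sym sym) (zs ≟ₗ ws) (ws ≟ₗ zs)) _)) _) ⟩
    ∑ₗ (removals x ys) (λ ws → occₗ ws (permutations xs))
      ≡⟨ ∑ₗ-cong (removals x ys) (All.map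
           (λ x∷ws↭ys → occₗ-permutations (↭.drop-∷ (↭-trans x∷ws↭ys ys↭x∷xs))) (removals-↭ x ys)) ⟩
    ∑ₗ (removals x ys) (λ _ → ∏occ! xs)
      ≡⟨ ∑ₗ-const (removals x ys) (∏occ! xs) ⟩
    List.length (removals x ys) ℕ.* ∏occ! xs
      ≡⟨ cong (ℕ._* ∏occ! xs) (≡-trans (length-removals x ys) (≡-trans (∑ₗ-↭ _ ys↭x∷xs) (occ-∷-≡ x xs))) ⟩
    ∏occ! (x ∷ xs)
      ∎
    where open ≡-Reasoning

  ∏occ!-↭ : ∀ {xs ys} → xs ↭ ys → ∏occ! xs ≡ ∏occ! ys
  ∏occ!-↭ refl            = refl
  ∏occ!-↭ (prep x p)      = cong₂ (λ k m → suc k ℕ.* m) (∑ₗ-↭ _ p) (∏occ!-↭ p)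
  ∏occ!-↭ (trans p q)     = ≡-trans (∏occ!-↭ p) (∏occ!-↭ q)
  ∏occ!-↭ {xs = _ ∷ _ ∷ xs} {_ ∷ _ ∷ ys} (swap x y p) = begin
    suc (𝟙 (x ≟ y) + occ x xs) ℕ.* (suc (occ y xs) ℕ.* ∏occ! xs)
      ≡⟨ cong₂ (λ k m → suc (𝟙 (x ≟ y) + k) ℕ.* m) (∑ₗ-↭ _ p) (cong₂ (λ k m → suc k ℕ.* m) (∑ₗ-↭ _ p) (∏occ!-↭ p)) ⟩
    suc (𝟙 (x ≟ y) + occ x ys) ℕ.* (suc (occ y ys) ℕ.* ∏occ! ys)
      ≡⟨ exchange (x ≟ y) ⟩
    suc (𝟙 (x ≟ y) + occ y ys) ℕ.* (suc (occ x ys) ℕ.* ∏occ! ys)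
      ≡⟨ cong (λ k → suc (k + occ y ys) ℕ.* (suc (occ x ys) ℕ.* ∏occ! ys)) (𝟙-cong (mk⇔ sym sym) (x ≟ y) (y ≟ x)) ⟩
    suc (𝟙 (y ≟ x) + occ y ys) ℕ.* (suc (occ x ys) ℕ.* ∏occ! ys)
      ∎
    where
    open ≡-Reasoning
    -- If x = y, both sides are the same term; otherwise the indicator is 0 and the two leading
    -- factors commute.
    exchange : (d : Dec (x ≡ y)) →
      suc (𝟙 d + occ x ys) ℕ.* (suc (occ y ys) ℕ.* ∏occ! ys) ≡ suc (𝟙 d + occ y ys) ℕ.* (suc (occ x ys) ℕ.* ∏occ! ys)
    exchange (yes refl) = refl
    exchange (no _)     = *-CS.x∙yz≈y∙xz (suc (occ x ys)) (suc (occ y ys)) (∏occ! ys)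

  occ-∉ : ∀ {x xs} → All (x ≢_) xs → occ x xs ≡ 0
  occ-∉ {xs = []}     []           = refl
  occ-∉ {xs = y ∷ ys} (x≢y ∷ x∉ys) = ≡-trans (occ-∷-≢ x≢y ys) (occ-∉ x∉ys)

  occ-∈ : ∀ {x xs} → Unique xs → x ∈ xs → occ x xs ≡ 1
  occ-∈ {x} {_ ∷ xs} (x∉xs ∷ _)   (here refl)  =
    ≡-trans (occ-∷-≡ x xs) (cong suc (occ-∉ x∉xs))
  occ-∈ {x} {_ ∷ xs} (y∉xs ∷ xs!) (there x∈xs) =
    ≡-trans (occ-∷-≢ (λ { refl → All.lookup y∉xs x∈xs refl }) xs) (occ-∈ xs! x∈xs)

  -- This is the effect of one more o-block: its colours are distinct and each already occurs `c`
  -- times, so every one of them raises its factorial from c! to (c+1)!.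
  ∏occ!-++ : ∀ {xs} c ys → Unique xs → All (λ x → occ x ys ≡ c) xs →
             ∏occ! (xs ++ ys) ≡ suc c ^ List.length xs ℕ.* ∏occ! ys
  ∏occ!-++ c ys [] [] = sym (ℕ.*-identityˡ _)
  ∏occ!-++ {x ∷ xs} c ys (x∉xs ∷ xs!) (eq ∷ eqs) = ≡-trans
    (cong₂ (λ k m → suc k ℕ.* m)
      (≡-trans (∑ₗ-++ _ xs ys) (cong₂ _+_ (occ-∉ x∉xs) eq)) (∏occ!-++ c ys xs! eqs))
    (sym (ℕ.*-assoc (suc c) (suc c ^ List.length xs) (∏occ! ys)))

-- Given a solution i, uniqueness turns `P j` into `i ≡ j`, and i occurs once in `allFin m`. This
-- evaluates the sums over shifts, over types and over classes.
∑ₗ-𝟙-unique : ∀ {m} {P : Fin m → Set} (P? : ∀ i → Dec (P i)) → (∀ {i j} → P i → P j → i ≡ j) →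
             (d : Dec (∃ P)) → ∑ₗ (allFin m) (𝟙 ∘ P?) ≡ 𝟙 d
∑ₗ-𝟙-unique {m} P? unique (no ¬p)       = ∑ₗ-𝟙-none P? (allFin m) (All.universal (λ i pi → ¬p (i , pi)) _)
∑ₗ-𝟙-unique {m} {P} P? unique (yes (i , pi)) = ≡-trans
  (∑ₗ-cong (allFin m) (All.universal (λ j → 𝟙-cong (mk⇔ (unique pi) (λ i≡j → subst P i≡j pi)) (P? j) (i Fin.≟ j)) _))
  (Occurrences.occ-∈ Fin._≟_ (Unique.allFin⁺ m) (∈.∈-allFin i))

concatMap-↭ : ∀ (f : A → List B) {xs ys} → xs ↭ ys → concatMap f xs ↭ concatMap f ys
concatMap-↭ f refl         = ↭-refl
concatMap-↭ f (prep x p)   = ↭.++⁺ˡ (f x) (concatMap-↭ f p)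
concatMap-↭ f (swap x y p) =
  ↭-trans (↭.shifts (f x) (f y)) (↭.++⁺ˡ (f y) (↭.++⁺ˡ (f x) (concatMap-↭ f p)))
concatMap-↭ f (trans p q)  = ↭-trans (concatMap-↭ f p) (concatMap-↭ f q)

-- Residues

%-cong-+ʳ : ∀ a b c m .{{_ : NonZero m}} → a % m ≡ b % m → (a + c) % m ≡ (b + c) % m
%-cong-+ʳ a b c m eq = begin
  (a + c) % m          ≡⟨ %-distribˡ-+ a c m ⟩
  (a % m + c % m) % m  ≡⟨ cong (λ r → (r + c % m) % m) eq ⟩
  (b % m + c % m) % m  ≡⟨ %-distribˡ-+ b c m ⟨
  (b + c) % m          ∎
  where open ≡-Reasoning

-- c * k is an additive inverse of c modulo suc k.
[a+c*k+c]%m≡a%m : ∀ a c k → (a + c ℕ.* k + c) % suc k ≡ a % suc k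
[a+c*k+c]%m≡a%m a c k =
  ≡-trans (cong (_% suc k) regroup) ([m+kn]%n≡m%n a c (suc k))
  where
  regroup : a + c ℕ.* k + c ≡ a + c ℕ.* suc k
  regroup = ≡-trans (ℕ.+-assoc a (c ℕ.* k) c)
    (cong₂ _+_ refl (≡-trans (ℕ.+-comm (c ℕ.* k) c) (sym (ℕ.*-suc c k))))

%-cancel-+ʳ : ∀ a b c m .{{_ : NonZero m}} → (a + c) % m ≡ (b + c) % m → a % m ≡ b % m
%-cancel-+ʳ a b c (suc k) eq = begin
  a % suc k                  ≡⟨ [a+c*k+c]%m≡a%m a c k ⟨
  (a + c ℕ.* k + c) % suc k  ≡⟨ cong (_% suc k) (+-CS.xy∙z≈xz∙y a (c ℕ.* k) c) ⟩
  (a + c + c ℕ.* k) % suc k  ≡⟨ %-cong-+ʳ (a + c) (b + c) (c ℕ.* k) (suc k) eq ⟩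
  (b + c + c ℕ.* k) % suc k  ≡⟨ cong (_% suc k) (+-CS.xy∙z≈xz∙y b c (c ℕ.* k)) ⟩
  (b + c ℕ.* k + c) % suc k  ≡⟨ [a+c*k+c]%m≡a%m b c k ⟩
  b % suc k                  ∎
  where
  open ≡-Reasoning

%≡%⇒∣ : ∀ a b m .{{_ : NonZero m}} → a % m ≡ b % m → m ∣ ∣ a - b ∣
%≡%⇒∣ a b m eq = divides ∣ a ℕ./ m - b ℕ./ m ∣ (begin
  ∣ a - b ∣                                          ≡⟨ cong₂ ∣_-_∣ (m≡m%n+[m/n]*n a m) (m≡m%n+[m/n]*n b m) ⟩
  ∣ a % m + a ℕ./ m ℕ.* m - b % m + b ℕ./ m ℕ.* m ∣  ≡⟨ cong (λ r → ∣ a % m + a ℕ./ m ℕ.* m - r + b ℕ./ m ℕ.* m ∣) eq ⟨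
  ∣ a % m + a ℕ./ m ℕ.* m - a % m + b ℕ./ m ℕ.* m ∣  ≡⟨ ℕ.∣m+n-m+o∣≡∣n-o∣ (a % m) _ _ ⟩
  ∣ a ℕ./ m ℕ.* m - b ℕ./ m ℕ.* m ∣                  ≡⟨ ℕ.*-distribʳ-∣-∣ m (a ℕ./ m) (b ℕ./ m) ⟨
  ∣ a ℕ./ m - b ℕ./ m ∣ ℕ.* m                        ∎)
  where open ≡-Reasoning

-- As r < m, the number r itself lies in the common class. Modulo k, so does r + k, and two members
-- of a class modulo m differ by a multiple of m.
residue-class-∣ : ∀ {r s} m k .{{_ : NonZero m}} .{{_ : NonZero k}} → r < m →
                  (∀ ℓ → ℓ % m ≡ r ⇔ ℓ % k ≡ s) → m ∣ k
residue-class-∣ {r} m k r<m same = subst (m ∣_) (ℕ.∣m-m+n∣≡n r k)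
  (%≡%⇒∣ r (r + k) m (≡-trans r%m≡r (sym (from (same (r + k))
    (≡-trans ([m+n]%n≡m%n r k) (to (same r) r%m≡r))))))
  where
  r%m≡r : r % m ≡ r
  r%m≡r = m<n⇒m%n≡m r<m

-- Mutual divisibility identifies the moduli, and evaluating at r identifies the residues. Thus the
-- set of indices at which an element occurs determines its size and position.
residue-class-injective : ∀ {r s} m k .{{_ : NonZero m}} .{{_ : NonZero k}} → r < m → s < k →
  (∀ ℓ → ℓ % m ≡ r ⇔ ℓ % k ≡ s) → m ≡ k × r ≡ s
residue-class-injective {r} m k r<m s<k same with
  ∣-antisym (residue-class-∣ m k r<m same) (residue-class-∣ k m s<k (λ ℓ → mk⇔ (from (same ℓ)) (to (same ℓ))))
... | refl = refl , ≡-trans (sym r%m≡r) (to (same r) r%m≡r)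
  where
  r%m≡r : r % m ≡ r
  r%m≡r = m<n⇒m%n≡m r<m

-- Replaces the integer subtraction inside `σ` by a congruence of natural numbers, the form in which
-- the shift is used from here on.
toℕ-index-+ : ∀ p .{{_ : NonZero p}} ℓ i → (toℕ (index p (+ ℓ ℤ.- + i)) + i) % p ≡ ℓ % p
toℕ-index-+ p ℓ i = begin
  (toℕ j + i) % p           ≡⟨ Fin.toℕ-fromℕ< _ ⟨
  toℕ (index p (+ (toℕ j + i)))
    ≡⟨ cong toℕ (index-cong p {+ (toℕ j + i)} {+ ℓ} (ℤ.- ((+ ℓ ℤ.- + i) /ℕ p))
         (≡-trans (cong (ℤ._+ + i) (toℕ-index p (+ ℓ ℤ.- + i))) (regroup (+ ℓ) (+ i) ((+ ℓ ℤ.- + i) /ℕ p) (+ p)))) ⟩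
  toℕ (index p (+ ℓ))  ≡⟨ Fin.toℕ-fromℕ< _ ⟩
  ℓ % p                ∎
  where
  open ≡-Reasoning
  j = index p (+ ℓ ℤ.- + i)
  regroup : ∀ l i q p → l ℤ.- i ℤ.- q ℤ.* p ℤ.+ i ≡ l ℤ.+ ℤ.- q ℤ.* p
  regroup = solve-∀

-- The colouring of a partitioned order

Colour : Set
Colour = ℕ × ℕ

_≟ᶜ_ : DecidableEquality Colour
_≟ᶜ_ = Product.≡-dec ℕ._≟_ ℕ._≟_

open Occurrences ℕ._≟_ using () renaming
  (occ to occᴺ; occ-∷-≡ to occᴺ-∷-≡; occ-∷-≢ to occᴺ-∷-≢)
open Occurrences _≟ᶜ_

phases : ℕ → List Colour
phases j = List.tabulate {n = j} λ r → j , toℕ r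

-- The fixed word: a concatenation of o-blocks of sizes `js`, each element coloured by size and
-- position, reads exactly this.
colours : List ℕ → List Colour
colours = concatMap phases

phases-! : ∀ j → Unique (phases j)
phases-! j = Unique.tabulate⁺ {f = λ r → j , toℕ r} λ eq → Fin.toℕ-injective (cong proj₂ eq)

-- Adding i is a bijection of the residues modulo `suc k`, so both lists are free of duplicates and
-- have the same members.
rotation-↭ : ∀ i k → List.tabulate {n = suc k} (λ r → suc k , (toℕ r + i) % suc k) ↭ phases (suc k)
rotation-↭ i k = ∼bag⇒↭ (unique∧set⇒bag
  (Unique.tabulate⁺ {f = rotated} λ eq → injective (cong proj₂ eq))
  (phases-! m)
  (mk⇔ ⊆phases phases⊆))
  where
  m = suc k

  rotated : Fin m → Colour
  rotated r = m , (toℕ r + i) % m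

  phase : Fin m → Colour
  phase r = m , toℕ r

  toℕ% : ∀ (r : Fin m) → toℕ r % m ≡ toℕ r
  toℕ% r = m<n⇒m%n≡m (Fin.toℕ<n r)

  injective : ∀ {r s : Fin m} → (toℕ r + i) % m ≡ (toℕ s + i) % m → r ≡ s
  injective {r} {s} eq = Fin.toℕ-injective
    (≡-trans (sym (toℕ% r)) (≡-trans (%-cancel-+ʳ (toℕ r) (toℕ s) i m eq) (toℕ% s)))

  ⊆phases : ∀ {c} → c ∈ List.tabulate rotated → c ∈ List.tabulate phase
  ⊆phases c∈ with r , refl ← ∈.∈-tabulate⁻ {f = rotated} c∈ =
    subst (λ s → (m , s) ∈ List.tabulate phase) (Fin.toℕ-fromℕ< _)
      (∈.∈-tabulate⁺ {f = phase} ((toℕ r + i) mod m))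

  phases⊆ : ∀ {c} → c ∈ List.tabulate phase → c ∈ List.tabulate rotated
  phases⊆ c∈ with r , refl ← ∈.∈-tabulate⁻ {f = phase} c∈ =
    subst (λ s → (m , s) ∈ List.tabulate rotated) eq
      -- `i * k` acts as - i modulo `suc k`, so this index is the preimage of r under the rotation.
      (∈.∈-tabulate⁺ {f = rotated} ((toℕ r + i ℕ.* k) mod m))
    where
    open ≡-Reasoning
    eq : (toℕ ((toℕ r + i ℕ.* k) mod m) + i) % m ≡ toℕ r
    eq = begin
      (toℕ ((toℕ r + i ℕ.* k) mod m) + i) % m  ≡⟨ cong (λ s → (s + i) % m) (Fin.toℕ-fromℕ< (m%n<n (toℕ r + i ℕ.* k) m)) ⟩
      ((toℕ r + i ℕ.* k) % m + i) % m          ≡⟨ %-cong-+ʳ ((toℕ r + i ℕ.* k) % m) (toℕ r + i ℕ.* k) i m (m%n%n≡m%n (toℕ r + i ℕ.* k) m) ⟩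
      (toℕ r + i ℕ.* k + i) % m                ≡⟨ [a+c*k+c]%m≡a%m (toℕ r) i k ⟩
      toℕ r % m                                ≡⟨ toℕ% r ⟩
      toℕ r                                    ∎

-- A block of length j contributes exactly one colour with phase 0.
partsOf : List Colour → List ℕ
partsOf cs = map proj₁ (filter (λ c → proj₂ c ℕ.≟ 0) cs)

partsOf-colours : ∀ {js} → All NonZero js → partsOf (colours js) ≡ js
partsOf-colours {[]}         []       = refl
partsOf-colours {suc k ∷ js} (_ ∷ js≢0) = cong (suc k ∷_) (begin
  map proj₁ (filter P? (List.tabulate phase ++ colours js))
    ≡⟨ cong (map proj₁) (List.filter-++ P? (List.tabulate phase) (colours js)) ⟩
  map proj₁ (filter P? (List.tabulate phase) ++ filter P? (colours js))
    ≡⟨ cong (λ cs → map proj₁ (cs ++ filter P? (colours js)))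
         (List.filter-none P? (All.tabulate⁺ {f = phase} λ _ ())) ⟩
  partsOf (colours js)
    ≡⟨ partsOf-colours js≢0 ⟩
  js ∎)
  where
  open ≡-Reasoning
  P? = λ (c : Colour) → proj₂ c ℕ.≟ 0
  phase : Fin k → Colour
  phase r = suc k , suc (toℕ r)

colours-injective : ∀ {js ks} → All NonZero js → All NonZero ks → colours js ↭ colours ks → js ↭ ks
colours-injective {js} {ks} js≢0 ks≢0 p = ↭-trans (↭-reflexive (sym (partsOf-colours js≢0)))
  (↭-trans (↭.map⁺ proj₁ (↭.filter-↭ (λ c → proj₂ c ℕ.≟ 0) p)) (↭-reflexive (partsOf-colours ks≢0)))

occ-phases : ∀ {k} (r : Fin k) j → occ (k , toℕ r) (phases j) ≡ 𝟙 (k ℕ.≟ j)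
occ-phases {k} r j = cases (k ℕ.≟ j)
  where
  cases : Dec (k ≡ j) → occ (k , toℕ r) (phases j) ≡ 𝟙 (k ℕ.≟ j)
  cases (no k≢j)   = ≡-trans
    (occ-∉ {xs = phases j} (All.tabulate⁺ {f = λ r → j , toℕ r} λ _ eq → k≢j (cong proj₁ eq)))
    (sym (𝟙-no (k ℕ.≟ j) k≢j))
  cases (yes refl) = ≡-trans
    (occ-∈ {k , toℕ r} (phases-! k)
           (∈.∈-tabulate⁺ {f = λ r → k , toℕ r} r))
    (sym (𝟙-yes (k ℕ.≟ k) refl))

-- Every part equal to k contributes the colour (k, r) once, for each r < k. The multiplicity is
-- thus independent of r, and a size k accounts for k equal factorials.
occ-colours : ∀ {k} (r : Fin k) js → occ (k , toℕ r) (colours js) ≡ occᴺ k js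
occ-colours r []       = refl
occ-colours r (j ∷ js) = ≡-trans (∑ₗ-++ _ (phases j) (colours js))
  (cong₂ _+_ (occ-phases r j) (occ-colours r js))

-- The denominator and the lcm of an integer partition

-- The product in the denominator, with the range `ks` of part sizes separated from the parts `js`:
-- the induction on `js` keeps the range fixed. Sizes that do not occur contribute (0!)^k = 1.
∏occ!^ : List ℕ → List ℕ → ℕ
∏occ!^ ks js = product (map (λ k → (occᴺ k js !) ^ k) ks)

^-distribʳ-* : ∀ a b k → (a ℕ.* b) ^ k ≡ a ^ k ℕ.* b ^ k
^-distribʳ-* a b zero    = refl
^-distribʳ-* a b (suc k) = ≡-trans (cong (a ℕ.* b ℕ.*_) (^-distribʳ-* a b k)) (*-CS.interchange a b (a ^ k) (b ^ k))

∏occ!^-∉ : ∀ {j ks} js → All (j ≢_) ks → ∏occ!^ ks (j ∷ js) ≡ ∏occ!^ ks js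
∏occ!^-∉ js []                       = refl
∏occ!^-∉ {j} {k ∷ ks} js (j≢k ∷ j∉ks) =
  cong₂ (λ o m → (o !) ^ k ℕ.* m) (occᴺ-∷-≢ (j≢k ∘ sym) js) (∏occ!^-∉ js j∉ks)

∏occ!^-∈ : ∀ {j ks} js → Unique ks → j ∈ ks → ∏occ!^ ks (j ∷ js) ≡ suc (occᴺ j js) ^ j ℕ.* ∏occ!^ ks js
∏occ!^-∈ {j} {_ ∷ ks} js (j∉ks ∷ _) (here refl) = begin
  (occᴺ j (j ∷ js) !) ^ j ℕ.* ∏occ!^ ks (j ∷ js)
    ≡⟨ cong₂ (λ o m → (o !) ^ j ℕ.* m) (occᴺ-∷-≡ j js) (∏occ!^-∉ js j∉ks) ⟩
  (suc o ℕ.* o !) ^ j ℕ.* ∏occ!^ ks js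
    ≡⟨ cong (ℕ._* ∏occ!^ ks js) (^-distribʳ-* (suc o) (o !) j) ⟩
  suc o ^ j ℕ.* (o !) ^ j ℕ.* ∏occ!^ ks js
    ≡⟨ ℕ.*-assoc (suc o ^ j) ((o !) ^ j) _ ⟩
  suc o ^ j ℕ.* ((o !) ^ j ℕ.* ∏occ!^ ks js) ∎
  where
  open ≡-Reasoning
  o = occᴺ j js
∏occ!^-∈ {j} {k ∷ ks} js (k∉ks ∷ ks!) (there j∈ks) = ≡-trans
  (cong₂ (λ o m → (o !) ^ k ℕ.* m) (occᴺ-∷-≢ (All.lookup k∉ks j∈ks) js) (∏occ!^-∈ js ks! j∈ks))
  (*-CS.x∙yz≈y∙xz ((occᴺ k js !) ^ k) (suc (occᴺ j js) ^ j) (∏occ!^ ks js))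

-- One more part j multiplies both sides by `suc (occᴺ j js) ^ j`: on the left through its j new
-- colours, on the right through the single factor at j.
∏occ!-colours : ∀ {ks js} → Unique ks → All (_∈ ks) js → ∏occ! (colours js) ≡ ∏occ!^ ks js
∏occ!-colours {ks} {[]} ks! [] = sym (ones ks)
  where
  ones : ∀ ks → ∏occ!^ ks [] ≡ 1
  ones []       = refl
  ones (k ∷ ks) = cong₂ ℕ._*_ (ℕ.^-zeroˡ k) (ones ks)
∏occ!-colours {ks} {j ∷ js} ks! (j∈ks ∷ js⊆ks) = begin
  ∏occ! (phases j ++ colours js)
    ≡⟨ ∏occ!-++ {phases j} (occᴺ j js) (colours js) (phases-! j)
         (All.tabulate⁺ {f = λ r → j , toℕ r} λ r → occ-colours r js) ⟩
  suc (occᴺ j js) ^ List.length (phases j) ℕ.* ∏occ! (colours js)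
    ≡⟨ cong₂ (λ l m → suc (occᴺ j js) ^ l ℕ.* m) (List.length-tabulate {n = j} _) (∏occ!-colours ks! js⊆ks) ⟩
  suc (occᴺ j js) ^ j ℕ.* ∏occ!^ ks js
    ≡⟨ ∏occ!^-∈ js ks! j∈ks ⟨
  ∏occ!^ ks (j ∷ js) ∎
  where open ≡-Reasoning

lcms-least : ∀ {ns m} → All (_∣ m) ns → lcms ns ∣ m
lcms-least []         = 1∣ _
lcms-least (p ∷ ps) = lcm-least p (lcms-least ps)

∣lcms : ∀ ns → All (_∣ lcms ns) ns
∣lcms []       = []
∣lcms (n ∷ ns) = m∣lcm[m,n] n (lcms ns) ∷ All.map (λ p → ∣-trans p (n∣lcm[m,n] n (lcms ns))) (∣lcms ns)

occᴺ≡length-filter : ∀ j ks → List.length (filter (j ℕ.≟_) ks) ≡ occᴺ j ks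
occᴺ≡length-filter j []       = refl
occᴺ≡length-filter j (k ∷ ks) with does (j ℕ.≟ k)
... | true  = cong suc (occᴺ≡length-filter j ks)
... | false = occᴺ≡length-filter j ks

module _ {n : ℕ} (π : IntegerPartition n) where

  parts∈1⋯max : All (_∈ 1⋯max π) (parts π)
  parts∈1⋯max = bounded (positive π) ℕ.≤-refl
    where
    -- An arbitrary bound d replaces the maximum, which would change from one tail to the next.
    bounded : ∀ {d js} → All NonZero js → List.foldr _⊔_ 0 js ≤ d → All (_∈ map suc (upTo d)) js
    bounded []                               _  = []
    bounded {js = suc j ∷ js} (_ ∷ js≢0) ≤d =
      ∈.∈-map⁺ suc (∈.∈-upTo⁺ (ℕ.≤-trans (ℕ.m≤m⊔n (suc j) (List.foldr _⊔_ 0 js)) ≤d)) ∷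
      bounded {js = js} js≢0 (ℕ.≤-trans (ℕ.m≤n⊔m (suc j) (List.foldr _⊔_ 0 js)) ≤d)

  ∏m!^j≡∏occ! : ∏m!^j π ≡ ∏occ! (colours (parts π))
  ∏m!^j≡∏occ! = ≡-trans
    (cong product (List.map-cong (λ j → cong (λ m → (m !) ^ j) (occᴺ≡length-filter j (parts π))) (1⋯max π)))
    (sym (∏occ!-colours (Unique.map⁺ ℕ.suc-injective (Unique.upTo⁺ _)) parts∈1⋯max))

  -- The lcm sees only which numbers occur, not how often, and the two lists have the same members;
  -- hence each lcm divides the other.
  lcmOfParts≡lcms : lcmOfParts π ≡ lcms (parts π)
  lcmOfParts≡lcms = ∣-antisym
    (lcms-least (All.map (λ {j} 1≤m → All.lookup (∣lcms (parts π)) (occurring j 1≤m)) (All.all-filter _ (1⋯max π))))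
    (lcms-least (All.tabulate λ {j} j∈ → All.lookup (∣lcms _)
      (∈.∈-filter⁺ (λ j → 1 ℕ.≤? multiplicity π j) (All.lookup parts∈1⋯max j∈) (∈.∈-length (∈.∈-filter⁺ (j ℕ.≟_) j∈ refl)))))
    where
    occurring : ∀ j → 1 ≤ multiplicity π j → j ∈ parts π
    occurring j 1≤m with filter (j ℕ.≟_) (parts π) in eq
    ... | k ∷ _ with k∈ , refl ← ∈.∈-filter⁻ (j ℕ.≟_) {xs = parts π} (subst (k ∈_) (sym eq) (here refl)) = k∈

-- O-block, size and position of an element

∈-⋃ : ∀ {n} {x : Fin n} ps → x Subset.∈ Subset.⋃ ps ⇔ Any (x Subset.∈_) ps
∈-⋃ ps = mk⇔ (⇒ ps) ⇐
  where
  ⇒ : ∀ ps → _ Subset.∈ Subset.⋃ ps → Any (_ Subset.∈_) ps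
  ⇒ []       x∈⊥ = contradiction x∈⊥ Subset.∉⊥
  ⇒ (p ∷ ps) x∈  with Subset.x∈p∪q⁻ p (Subset.⋃ ps) x∈
  ... | inj₁ x∈p  = here x∈p
  ... | inj₂ x∈ps = there (⇒ ps x∈ps)
  ⇐ : ∀ {ps} → Any (_ Subset.∈_) ps → _ Subset.∈ Subset.⋃ ps
  ⇐ (here x∈p)   = Subset.x∈p∪q⁺ (inj₁ x∈p)
  ⇐ (there x∈ps) = Subset.x∈p∪q⁺ (inj₂ (⇐ x∈ps))

disjoint⇒≡ : ∀ {x : A} {Ss S T} → AllPairs (Disjoint on toList) Ss →
             S ∈ Ss → T ∈ Ss → x ∈ toList S → x ∈ toList T → S ≡ T
disjoint⇒≡ _            (here refl) (here refl) _   _   = refl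
disjoint⇒≡ (S# ∷ _)     (here refl) (there T∈)  x∈S x∈T = contradiction (x∈S , x∈T) (All.lookup S# T∈)
disjoint⇒≡ (T# ∷ _)     (there S∈)  (here refl) x∈S x∈T = contradiction (x∈T , x∈S) (All.lookup T# S∈)
disjoint⇒≡ (_ ∷ Ss#)    (there S∈)  (there T∈)  x∈S x∈T = disjoint⇒≡ Ss# S∈ T∈ x∈S x∈T

module _ {n : ℕ} (μ : PartitionedOrder n) where

  private instance
    _ = period≢0 μ

  blockOf : Fin n → List⁺ (Fin n)
  blockOf x = proj₁ (find (covering μ x))

  blockOf∈ : ∀ x → blockOf x ∈ o-blocks μ
  blockOf∈ x = proj₁ (proj₂ (find (covering μ x)))

  ∈blockOf : ∀ x → x ∈ toList (blockOf x)
  ∈blockOf x = proj₂ (proj₂ (find (covering μ x)))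

  size : Fin n → ℕ
  size x = length (blockOf x)

  position : ∀ x → Fin (size x)
  position x = Any.index (∈blockOf x)

  -- Block and position are compared as one dependent pair, since the type of the position depends
  -- on the block. Disjointness identifies the block, distinctness of its entries the position.
  located : ∀ {S x} → S ∈ o-blocks μ → (r : Fin (length S)) → List.lookup (toList S) r ≡ x →
            (Σ (List⁺ (Fin n)) (Fin ∘ length) ∋ (blockOf x , position x)) ≡ (S , r)
  located {S} {x} S∈ r refl
    with blockOf x | blockOf∈ x | ∈blockOf x | Any.lookup-index (∈blockOf x)
  ... | T | T∈ | x∈T | x≡ with disjoint⇒≡ (disjoint μ) T∈ S∈ x∈T (∈.∈-lookup r)
  ... | refl = cong (S ,_) (unique-lookup (Fin.≡-decSetoid n) (All.lookup (distinct μ) S∈) (Any.index x∈T) r (sym x≡))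

  -- x lies in W_ℓ iff ℓ ≡ position x modulo size x, and hence in the block of index ℓ
  -- of σ^i(φ(μ)) iff ℓ ≡ position x + i.
  colour : ℕ → Fin n → Colour
  colour i x = size x , (toℕ (position x) + i) % size x

  map-colour : ∀ i {S} → S ∈ o-blocks μ →
               map (colour i) (toList S) ≡ List.tabulate λ (r : Fin (length S)) → length S , (toℕ r + i) % length S
  map-colour i {S} S∈ = begin
    map (colour i) (toList S)                                ≡⟨ cong (map (colour i)) (List.tabulate-lookup (toList S)) ⟨
    map (colour i) (List.tabulate (List.lookup (toList S)))  ≡⟨ List.map-tabulate (List.lookup (toList S)) (colour i) ⟩
    List.tabulate (colour i ∘ List.lookup (toList S))
      ≡⟨ List.tabulate-cong (λ r → cong (λ (T , s) → length T , (toℕ s + i) % length T) (located S∈ r refl)) ⟩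
    List.tabulate (λ r → length S , (toℕ r + i) % length S)  ∎
    where open ≡-Reasoning

  ∈-block : ∀ x ℓ → x Subset.∈ block (o-blocks μ) ℓ ⇔ ℓ % size x ≡ toℕ (position x)
  ∈-block x ℓ = mk⇔ ⇒ ⇐
    where
    singleton = λ S → Subset.⁅ cyclicLookup S ℓ ⁆
    ⇒ : x Subset.∈ block (o-blocks μ) ℓ → ℓ % size x ≡ toℕ (position x)
    ⇒ x∈ with S , S∈ , x∈S ← find (Any.map⁻ (to (∈-⋃ (map singleton (o-blocks μ))) x∈)) =
      subst (λ (T , s) → ℓ % length T ≡ toℕ s)
        (sym (located S∈ (ℓ mod length S) (sym (Subset.x∈⁅y⁆⇒x≡y _ x∈S))))
        (sym (Fin.toℕ-fromℕ< (m%n<n ℓ (length S))))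
    ⇐ : ℓ % size x ≡ toℕ (position x) → x Subset.∈ block (o-blocks μ) ℓ
    ⇐ eq = from (∈-⋃ (map singleton (o-blocks μ))) (Any.map⁺ (lose (blockOf∈ x)
      (from Subset.x∈⁅y⁆⇔x≡y (≡-trans (Any.lookup-index (∈blockOf x))
        (cong (List.lookup (toList (blockOf x))) (Fin.toℕ-injective
          (≡-trans (sym eq) (sym (Fin.toℕ-fromℕ< (m%n<n ℓ (size x)))))))))))

  size∣period : ∀ x → size x ∣ period μ
  size∣period x = All.lookup (All.map⁻ (∣lcms (map length (o-blocks μ)))) (blockOf∈ x)

  -- O-blocks are nonempty, so the length of each is the size of an element, namely its head. The
  -- period can then be handled through elements alone.
  period-least : ∀ {m} → (∀ x → size x ∣ m) → period μ ∣ m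
  period-least {m} size∣m = lcms-least (All.map⁺ (All.tabulate λ {S} S∈ →
    subst (λ (T , _) → length T ∣ m) (located S∈ zero refl) (size∣m (List⁺.head S))))

  concat-o-blocks-! : Unique (concatMap toList (o-blocks μ))
  concat-o-blocks-! = Unique.concat⁺ (All.map⁺ (distinct μ)) (AllPairs.map⁺ (disjoint μ))

  concat-o-blocks-↭ : concatMap toList (o-blocks μ) ↭ allFin n
  concat-o-blocks-↭ = ∼bag⇒↭ (unique∧set⇒bag concat-o-blocks-! (Unique.allFin⁺ n)
    (mk⇔ (λ _ → ∈.∈-allFin _) (λ _ → ∈.∈-concatMap⁺ toList (covering μ _))))

  typeOf : IntegerPartition n
  typeOf = record
    { parts    = map length (o-blocks μ)
    ; positive = All.map⁺ (All.universal (λ _ → _) (o-blocks μ))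
    ; total    = begin
        sum (map length (o-blocks μ))                ≡⟨ length-concatMap (o-blocks μ) ⟨
        List.length (concatMap toList (o-blocks μ))  ≡⟨ ↭.↭-length concat-o-blocks-↭ ⟩
        List.length (allFin n)                       ≡⟨ List.length-tabulate {n = n} id ⟩
        n                                            ∎
    }
    where
    open ≡-Reasoning
    length-concatMap : ∀ (Ss : List (List⁺ (Fin n))) → List.length (concatMap toList Ss) ≡ sum (map length Ss)
    length-concatMap []       = refl
    length-concatMap (S ∷ Ss) = ≡-trans (List.length-++ (toList S)) (cong (λ l → length S + l) (length-concatMap Ss))

  map-colour-concat : map (colour 0) (concatMap toList (o-blocks μ)) ≡ colours (parts typeOf)
  map-colour-concat = go (All.tabulate λ {S} S∈ → ≡-trans (map-colour 0 S∈)
    (List.tabulate-cong λ (r : Fin (length S)) → cong (length S ,_)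
      (≡-trans (cong (_% length S) (ℕ.+-identityʳ (toℕ r))) (m<n⇒m%n≡m (Fin.toℕ<n r)))))
    where
    go : ∀ {Ss} → All (λ S → map (colour 0) (toList S) ≡ phases (length S)) Ss →
         map (colour 0) (concatMap toList Ss) ≡ colours (map length Ss)
    go []                    = refl
    go {S ∷ Ss} (eq ∷ eqs) = ≡-trans (List.map-++ (colour 0) (toList S) (concatMap toList Ss))
      (cong₂ _++_ eq (go eqs))

  -- A shift only rotates the phases inside each o-block, so the multiset of colours does not depend
  -- on i. For this reason every shift contributes the same number of orders.
  map-colour-↭ : ∀ i → map (colour i) (allFin n) ↭ colours (parts typeOf)
  map-colour-↭ i = ↭-trans (↭.map⁺ (colour i) (↭-sym concat-o-blocks-↭))
    (go (All.tabulate λ {S} S∈ → ↭-trans (↭-reflexive (map-colour i S∈)) (rotation-↭ i (List.length (List⁺.tail S)))))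
    where
    go : ∀ {Ss} → All (λ S → map (colour i) (toList S) ↭ phases (length S)) Ss →
         map (colour i) (concatMap toList Ss) ↭ colours (map length Ss)
    go []                  = ↭-refl
    go {S ∷ Ss} (p ∷ ps) = ↭-trans (↭-reflexive (List.map-++ (colour i) (toList S) (concatMap toList Ss)))
      (↭.++⁺ p (go ps))

  -- Every size divides the period, so the congruence modulo the period descends to `size x`.
  -- Keeping j abstract serves both the unshifted side, with i = 0, and the index that `σ` reads.
  ∈-block-shift : ∀ x i j ℓ → (j + i) % period μ ≡ ℓ % period μ →
                  x Subset.∈ block (o-blocks μ) j ⇔ ℓ % size x ≡ (toℕ (position x) + i) % size x
  ∈-block-shift x i j ℓ eq = mk⇔
    (λ x∈ → ≡-trans (sym j+i≡ℓ) (%-cong-+ʳ j (toℕ (position x)) i (size x) (≡-trans (to (∈-block x j) x∈) (sym pos%≡pos))))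
    (λ ℓ≡ → from (∈-block x j) (≡-trans (%-cancel-+ʳ j (toℕ (position x)) i (size x) (≡-trans j+i≡ℓ ℓ≡)) pos%≡pos))
    where
    open ≡-Reasoning
    pos%≡pos : toℕ (position x) % size x ≡ toℕ (position x)
    pos%≡pos = m<n⇒m%n≡m (Fin.toℕ<n (position x))
    j+i≡ℓ : (j + i) % size x ≡ ℓ % size x
    j+i≡ℓ = begin
      (j + i) % size x             ≡⟨ m∣n⇒o%n%m≡o%m (size x) (period μ) (j + i) (size∣period x) ⟨
      (j + i) % period μ % size x  ≡⟨ cong (_% size x) eq ⟩
      ℓ % period μ % size x        ≡⟨ m∣n⇒o%n%m≡o%m (size x) (period μ) ℓ (size∣period x) ⟩
      ℓ % size x                   ∎

-- Shifts of φ

-- The lengths are not equal by definition, so indices are matched through `toℕ`.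
tabulate-toList-≡⁺ : ∀ {p q} {f : Fin p → A} {g : Fin q → A} → p ≡ q → (∀ a b → toℕ a ≡ toℕ b → f a ≡ g b) →
                     Vec.toList (Vec.tabulate f) ≡ Vec.toList (Vec.tabulate g)
tabulate-toList-≡⁺ refl f≗g = cong Vec.toList (Vec.tabulate-cong λ a → f≗g a a refl)

tabulate-toList-≡⁻ : ∀ {p q} {f : Fin p → A} {g : Fin q → A} →
                     Vec.toList (Vec.tabulate f) ≡ Vec.toList (Vec.tabulate g) →
                     p ≡ q × (∀ a b → toℕ a ≡ toℕ b → f a ≡ g b)
tabulate-toList-≡⁻ {f = f} {g} eq with toList-length (Vec.tabulate f) (Vec.tabulate g) eq
... | refl = refl , λ a b a≡b → begin
    f a                            ≡⟨ Vec.lookup∘tabulate f a ⟨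
    Vec.lookup (Vec.tabulate f) a  ≡⟨ cong₂ Vec.lookup f≡g (Fin.toℕ-injective a≡b) ⟩
    Vec.lookup (Vec.tabulate g) b  ≡⟨ Vec.lookup∘tabulate g b ⟩
    g b                            ∎
  where
  open ≡-Reasoning
  f≡g : Vec.tabulate f ≡ Vec.tabulate g
  f≡g = ≡-trans (sym (Vec.cast-is-id refl (Vec.tabulate f))) (Vec.toList-injective refl _ _ eq)

module _ {n : ℕ} (ν μ : PartitionedOrder n) (i : ℕ) where

  private instance
    _ = period≢0 ν
    _ = period≢0 μ

  Shifted : Set
  Shifted = Vec.toList (φ ν) ≡ Vec.toList (σ (+ i) (φ μ))

  unshifted : ℕ → ℕ
  unshifted ℓ = toℕ (index (period μ) (+ ℓ ℤ.- + i))

  lookup-φ : ∀ ℓ → Vec.lookup (φ μ) (index (period μ) (+ ℓ ℤ.- + i)) ≡ block (o-blocks μ) (unshifted ℓ)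
  lookup-φ ℓ = Vec.lookup∘tabulate (block (o-blocks μ) ∘ toℕ) (index (period μ) (+ ℓ ℤ.- + i))

  Shifted⇒colour : Shifted → ∀ x → colour ν 0 x ≡ colour μ i x
  Shifted⇒colour eq x = Product.×-≡,≡→≡ (residue-class-injective (size ν x) (size μ x)
      (m%n<n (toℕ (position ν x) + 0) (size ν x)) (m%n<n (toℕ (position μ x) + i) (size μ x)) same)
    where
    period≡ = proj₁ (tabulate-toList-≡⁻ eq)
    blocks≡ = proj₂ (tabulate-toList-≡⁻ eq)
    same : ∀ ℓ → ℓ % size ν x ≡ (toℕ (position ν x) + 0) % size ν x ⇔ ℓ % size μ x ≡ (toℕ (position μ x) + i) % size μ x
    same ℓ = mk⇔
      (to in-μ ∘ subst (x Subset.∈_) block≡ ∘ from in-ν)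
      (to in-ν ∘ subst (x Subset.∈_) (sym block≡) ∘ from in-μ)
      where
      toℕ-mod : ∀ p .{{_ : NonZero p}} → toℕ (ℓ mod p) ≡ ℓ % p
      toℕ-mod p = Fin.toℕ-fromℕ< (m%n<n ℓ p)
      -- A residue class ranges over all ℓ, but `φ` has entries only below the period. Reducing ℓ is
      -- harmless because the sizes divide the periods.
      a = toℕ (ℓ mod period ν)
      b = toℕ (ℓ mod period μ)
      block≡ : block (o-blocks ν) a ≡ block (o-blocks μ) (unshifted b)
      block≡ = ≡-trans (blocks≡ (ℓ mod period ν) (ℓ mod period μ)
        (≡-trans (toℕ-mod (period ν)) (≡-trans (%-congʳ {o = ℓ} period≡) (sym (toℕ-mod (period μ)))))) (lookup-φ b)
      in-ν = ∈-block-shift ν x 0 a ℓ (≡-trans (cong (_% period ν) (≡-trans (ℕ.+-identityʳ a) (toℕ-mod (period ν)))) (m%n%n≡m%n ℓ (period ν)))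
      in-μ = ∈-block-shift μ x i (unshifted b) ℓ (≡-trans (toℕ-index-+ (period μ) b i)
        (≡-trans (cong (_% period μ) (toℕ-mod (period μ))) (m%n%n≡m%n ℓ (period μ))))

  -- Equal sizes make each period divide the other, so the lengths agree; the blocks then agree
  -- element by element, since membership is a residue condition on the colour.
  colour⇒Shifted : (∀ x → colour ν 0 x ≡ colour μ i x) → Shifted
  colour⇒Shifted colour≡ = tabulate-toList-≡⁺
    (∣-antisym (period-least ν λ x → subst (_∣ period μ) (sym (size≡ x)) (size∣period μ x))
               (period-least μ λ x → subst (_∣ period ν) (size≡ x) (size∣period ν x)))
    λ a b a≡b → ≡-trans (block≡ (toℕ a) (toℕ b) a≡b) (sym (lookup-φ (toℕ b)))
    where
    size≡ : ∀ x → size ν x ≡ size μ x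
    size≡ x = cong proj₁ (colour≡ x)
    block≡ : ∀ a b → a ≡ b → block (o-blocks ν) a ≡ block (o-blocks μ) (unshifted b)
    block≡ ℓ .ℓ refl = Subset.⊆-antisym
      (λ {x} → from (in-μ x) ∘ residue⇒ x ∘ to (in-ν x))
      (λ {x} → from (in-ν x) ∘ residue⇐ x ∘ to (in-μ x))
      where
      in-ν = λ x → ∈-block-shift ν x 0 ℓ ℓ (cong (_% period ν) (ℕ.+-identityʳ ℓ))
      in-μ = λ x → ∈-block-shift μ x i (unshifted ℓ) ℓ (toℕ-index-+ (period μ) ℓ i)
      residue⇒ : ∀ x → ℓ % size ν x ≡ (toℕ (position ν x) + 0) % size ν x → ℓ % size μ x ≡ (toℕ (position μ x) + i) % size μ x
      residue⇒ x eq = ≡-trans (sym (%-congʳ {o = ℓ} (size≡ x))) (≡-trans eq (cong proj₂ (colour≡ x)))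
      residue⇐ : ∀ x → ℓ % size μ x ≡ (toℕ (position μ x) + i) % size μ x → ℓ % size ν x ≡ (toℕ (position ν x) + 0) % size ν x
      residue⇐ x eq = ≡-trans (%-congʳ {o = ℓ} (size≡ x)) (≡-trans eq (sym (cong proj₂ (colour≡ x))))

colour-injective : ∀ {n} (μ : PartitionedOrder n) {i j} → i < period μ → j < period μ →
                   (∀ x → colour μ i x ≡ colour μ j x) → i ≡ j
colour-injective μ {i} {j} i<p j<p colour≡ = ℕ.∣m-n∣≡0⇒m≡n (small _ refl (period-least μ λ x →
  %≡%⇒∣ i j (size μ x) (%-cancel-+ʳ i j (toℕ (position μ x)) (size μ x)
    (≡-trans (cong (_% size μ x) (ℕ.+-comm i _)) (≡-trans (cong proj₂ (colour≡ x)) (cong (_% size μ x) (ℕ.+-comm _ j)))))))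
  where
  small : ∀ d → d ≡ ∣ i - j ∣ → period μ ∣ d → d ≡ 0
  small zero    _   _   = refl
  small (suc d) d≡ p∣d = contradiction (∣⇒≤ p∣d)
    (ℕ.<⇒≱ (subst (_< period μ) (sym d≡) (ℕ.≤-<-trans (ℕ.∣m-n∣≤m⊔n i j) (ℕ.⊔-pres-<m i<p j<p))))

-- The size of an equivalence class

split-blocks : ∀ {js} → All NonZero js → ∀ (v : List A) → List.length v ≡ sum js →
               ∃ λ Ss → concatMap toList Ss ≡ v × map length Ss ≡ js
split-blocks []       []      _  = [] , refl , refl
split-blocks {js = suc k ∷ js} (_ ∷ js≢0) (x ∷ v) eq =
  let Ss , concat≡ , lengths≡ = split-blocks js≢0 (List.drop k v) (≡-trans (List.length-drop k v)
        (≡-trans (cong (_∸ k) length≡) (ℕ.m+n∸m≡n k (sum js))))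
  in  (x List⁺.∷ List.take k v) ∷ Ss ,
      cong (x ∷_) (≡-trans (cong (List.take k v ++_) concat≡) (List.take++drop≡id k v)) ,
      cong₂ (λ l ls → suc l ∷ ls) (≡-trans (List.length-take k v)
        (ℕ.m≤n⇒m⊓n≡m (subst (k ≤_) (sym length≡) (ℕ.m≤m+n k (sum js))))) lengths≡
  where
  length≡ : List.length v ≡ k + sum js
  length≡ = ℕ.suc-injective eq

Unique-++⁻ : ∀ (xs : List A) {ys} → Unique (xs ++ ys) → Unique xs × Unique ys × Disjoint xs ys
Unique-++⁻ []       ys!       = [] , ys! , λ ()
Unique-++⁻ (x ∷ xs) (x∉ ∷ xsys!) with xs! , ys! , xs#ys ← Unique-++⁻ xs xsys! =
  All.++⁻ˡ xs x∉ ∷ xs! , ys! , λ where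
    (here refl , x∈ys)  → All.lookup (All.++⁻ʳ xs x∉) x∈ys refl
    (there y∈xs , y∈ys) → xs#ys (y∈xs , y∈ys)

Unique-concatMap⁻ : ∀ (Ss : List (List⁺ A)) → Unique (concatMap toList Ss) →
                    All (Unique ∘ toList) Ss × AllPairs (Disjoint on toList) Ss
Unique-concatMap⁻ []       _ = [] , []
Unique-concatMap⁻ (S ∷ Ss) SSs! with S! , Ss! , S#Ss ← Unique-++⁻ (toList S) SSs!
                               with Ss!! , Ss# ← Unique-concatMap⁻ Ss Ss! =
  S! ∷ Ss!! , All.tabulate (λ T∈ (x∈S , x∈T) → S#Ss (x∈S , ∈.∈-concatMap⁺ toList (lose T∈ x∈T))) ∷ Ss#

module _ {n : ℕ} (π : IntegerPartition n) where

  arrangement : ∀ {v} → v ↭ allFin n → ∃ λ (ν : PartitionedOrder n) →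
                concatMap toList (o-blocks ν) ≡ v × map length (o-blocks ν) ≡ parts π
  arrangement {v} v↭ with split-blocks (positive π) v
    (≡-trans (↭.↭-length v↭) (≡-trans (List.length-tabulate {n = n} id) (sym (total π))))
  ... | Ss , refl , lengths≡ = ν , refl , lengths≡
    where
    v! : Unique v
    v! = ↭ₛ.Unique-resp-↭ (setoid (Fin n)) (↭⇒↭ₛ (↭-sym v↭)) (Unique.allFin⁺ n)
    ν : PartitionedOrder n
    ν = record
      { o-blocks = Ss
      ; distinct = proj₁ (Unique-concatMap⁻ Ss v!)
      ; disjoint = proj₂ (Unique-concatMap⁻ Ss v!)
      ; covering = λ x → ∈.∈-concatMap⁻ toList (↭.∈-resp-↭ (↭-sym v↭) (∈.∈-allFin x))
      }

  -- Each permutation carries the proof from which `arrangement` derives distinctness, disjointness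
  -- and covering.
  orders : List (∃ λ v → v ↭ allFin n)
  orders = All.toList (permutations-↭ (allFin n))

  -- Deliberately with repetition: permuting o-blocks of equal size yields the same update mode
  -- again, and the list still has exactly n! entries.
  arrangements : List (PartitionedOrder n)
  arrangements = map (λ (_ , v↭) → proj₁ (arrangement v↭)) orders

  length-arrangements : List.length arrangements ≡ n !
  length-arrangements = begin
    List.length arrangements               ≡⟨ List.length-map _ orders ⟩
    List.length orders                     ≡⟨ length-toList (permutations-↭ (allFin n)) ⟩
    List.length (permutations (allFin n))  ≡⟨ length-permutations (allFin n) ⟩
    List.length (allFin n) !               ≡⟨ cong _! (List.length-tabulate {n = n} id) ⟩
    n !                                    ∎
    where
    open ≡-Reasoning
    length-toList : ∀ {A : Set} {P : A → Set} {xs} (pxs : All P xs) → List.length (All.toList pxs) ≡ List.length xs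
    length-toList []        = refl
    length-toList (_ ∷ pxs) = cong suc (length-toList pxs)

infix 4 _≡⋆?_
_≡⋆?_ : ∀ {n} (ν μ : PartitionedOrder n) → Dec (ν ≡⋆ μ)
ν ≡⋆? μ = Fin.any? λ i → List.≡-dec (Vec.≡-dec Bool._≟_) (Vec.toList (φ ν)) (Vec.toList (σ (+ toℕ i) (φ μ)))

module _ {n : ℕ} (π : IntegerPartition n) (μ : PartitionedOrder n) where

  module _ {v : List (Fin n)} (v↭ : v ↭ allFin n) where

    private
      ν = proj₁ (arrangement π v↭)

    map-colour-arrangement : map (colour ν 0) v ≡ colours (parts π)
    map-colour-arrangement with arrangement π v↭
    ... | ν , refl , lengths≡ = ≡-trans (map-colour-concat ν) (cong colours lengths≡)

    -- Every element occurs in v, so equality of the two words read along v is equality of the two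
    -- colourings.
    Shifted⇔ : ∀ i → Shifted ν μ i ⇔ colours (parts π) ≡ map (colour μ i) v
    Shifted⇔ i = mk⇔
      (λ eq → ≡-trans (sym map-colour-arrangement) (List.map-cong (Shifted⇒colour ν μ i eq) v))
      (λ eq → colour⇒Shifted ν μ i λ x →
        pointwise (≡-trans map-colour-arrangement eq) (↭.∈-resp-↭ (↭-sym v↭) (∈.∈-allFin x)))
      where
      pointwise : ∀ {f g : A → B} {x xs} → map f xs ≡ map g xs → x ∈ xs → f x ≡ g x
      pointwise eq (here refl) = List.∷-injectiveˡ eq
      pointwise eq (there x∈)  = pointwise (List.∷-injectiveʳ eq) x∈

    -- Shifting preserves the multiset of colours, and the parts can be recovered from it: the type
    -- is an invariant of the class.
    ≡⋆⇒↭ : ν ≡⋆ μ → parts π ↭ parts (typeOf μ)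
    ≡⋆⇒↭ (i , eq) = colours-injective (positive π) (positive (typeOf μ)) (↭-trans
      (↭-reflexive (to (Shifted⇔ (toℕ i)) eq))
      (↭-trans (↭.map⁺ (colour μ (toℕ i)) v↭) (map-colour-↭ μ (toℕ i))))

    -- By `colour-injective` at most one shift below the period carries μ to ν, so the existential
    -- over shifts may be replaced by a sum.
    𝟙-≡⋆ : 𝟙 (ν ≡⋆? μ) ≡ ∑ₗ (allFin (period μ)) (λ i → 𝟙 (colours (parts π) ≟ₗ map (colour μ (toℕ i)) v))
    𝟙-≡⋆ = sym (≡-trans
      (∑ₗ-cong (allFin (period μ)) (All.universal (λ i →
        𝟙-cong (mk⇔ (from (Shifted⇔ (toℕ i))) (to (Shifted⇔ (toℕ i))))
          (colours (parts π) ≟ₗ map (colour μ (toℕ i)) v) (shifted? i)) _))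
      (∑ₗ-𝟙-unique shifted? (λ {i} {j} p q → Fin.toℕ-injective (colour-injective μ (Fin.toℕ<n i) (Fin.toℕ<n j)
        λ x → ≡-trans (sym (Shifted⇒colour ν μ (toℕ i) p x)) (Shifted⇒colour ν μ (toℕ j) q x))) (ν ≡⋆? μ)))
      where
      shifted? : ∀ i → Dec (Shifted ν μ (toℕ i))
      shifted? i = List.≡-dec (Vec.≡-dec Bool._≟_) (Vec.toList (φ ν)) (Vec.toList (σ (+ toℕ i) (φ μ)))

  class-size : parts π ↭ parts (typeOf μ) →
               ∑ₗ (arrangements π) (λ ν → 𝟙 (ν ≡⋆? μ)) ≡ lcmOfParts π ℕ.* ∏m!^j π
  class-size π↭μ = begin
    ∑ₗ (arrangements π) (λ ν → 𝟙 (ν ≡⋆? μ))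
      ≡⟨ ∑ₗ-map _ _ (orders π) ⟩
    ∑ₗ (orders π) (λ (_ , v↭) → 𝟙 (proj₁ (arrangement π v↭) ≡⋆? μ))
      ≡⟨ ∑ₗ-cong (orders π) (All.universal (λ (_ , v↭) → 𝟙-≡⋆ v↭) _) ⟩
    ∑ₗ (orders π) (shiftsTo ∘ proj₁)
      ≡⟨ ∑ₗ-toList shiftsTo (permutations-↭ (allFin n)) ⟩
    ∑ₗ (permutations (allFin n)) shiftsTo
      ≡⟨ ∑ₗ-comm _ (permutations (allFin n)) (allFin (period μ)) ⟩
    ∑ₗ (allFin (period μ)) (λ i → ∑ₗ (permutations (allFin n)) (λ v → 𝟙 (cs ≟ₗ map (colour μ (toℕ i)) v)))
      ≡⟨ ∑ₗ-cong (allFin (period μ)) (All.universal (λ i → perShift (toℕ i)) _) ⟩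
    ∑ₗ (allFin (period μ)) (λ _ → ∏m!^j π)
      ≡⟨ ∑ₗ-const (allFin (period μ)) (∏m!^j π) ⟩
    List.length (allFin (period μ)) ℕ.* ∏m!^j π
      ≡⟨ cong (ℕ._* ∏m!^j π) (List.length-tabulate {n = period μ} id) ⟩
    period μ ℕ.* ∏m!^j π
      -- `period μ` is by definition the lcm of the parts of `typeOf μ`, and the lcm is invariant
      -- under their reordering.
      ≡⟨ cong (ℕ._* ∏m!^j π) (≡-trans (foldr-↭ {n} lcm 1 (lcm-swap {n}) (↭-sym π↭μ)) (sym (lcmOfParts≡lcms π))) ⟩
    lcmOfParts π ℕ.* ∏m!^j π ∎
    where
    open ≡-Reasoning
    cs = colours (parts π)
    shiftsTo : List (Fin n) → ℕ
    shiftsTo v = ∑ₗ (allFin (period μ)) (λ i → 𝟙 (cs ≟ₗ map (colour μ (toℕ i)) v))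
    -- Colouring all permutations of `allFin n` is the same as permuting the list of colours, which
    -- has the same multiset as the word `cs`; so copies of `cs` are counted.
    perShift : ∀ i → ∑ₗ (permutations (allFin n)) (λ v → 𝟙 (cs ≟ₗ map (colour μ i) v)) ≡ ∏m!^j π
    perShift i = begin
      ∑ₗ (permutations (allFin n)) (λ v → 𝟙 (cs ≟ₗ map (colour μ i) v))
        ≡⟨ ∑ₗ-map (λ w → 𝟙 (cs ≟ₗ w)) (map (colour μ i)) (permutations (allFin n)) ⟨
      occₗ cs (map (map (colour μ i)) (permutations (allFin n)))
        ≡⟨ cong (occₗ cs) (permutations-map (colour μ i) (allFin n)) ⟨
      occₗ cs (permutations (map (colour μ i) (allFin n)))
        ≡⟨ occₗ-permutations (↭-sym rearranged) ⟩
      ∏occ! (map (colour μ i) (allFin n))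
        ≡⟨ ∏occ!-↭ rearranged ⟩
      ∏occ! cs
        ≡⟨ ∏m!^j≡∏occ! π ⟨
      ∏m!^j π ∎
      where
      rearranged : map (colour μ i) (allFin n) ↭ cs
      rearranged = ↭-trans (map-colour-↭ μ i) (concatMap-↭ phases (↭-sym π↭μ))

  -- With the indicator as a factor, a sum over classes of all types retains exactly those of type
  -- π.
  class-size-𝟙 : (same? : Dec (parts π ↭ parts (typeOf μ))) →
                 ∑ₗ (arrangements π) (λ ν → 𝟙 (ν ≡⋆? μ)) ≡ 𝟙 same? ℕ.* (lcmOfParts π ℕ.* ∏m!^j π)
  class-size-𝟙 (yes π↭μ) = ≡-trans (class-size π↭μ) (sym (ℕ.+-identityʳ _))
  class-size-𝟙 (no ¬π↭μ) = ∑ₗ-𝟙-none (_≡⋆? μ) (arrangements π)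
    (All.map⁺ (All.universal (λ (_ , v↭) → ¬π↭μ ∘ ≡⋆⇒↭ v↭) (orders π)))

-- Counting the classes

-- The operation `/` reduces fractions, so the identity is checked on unnormalised rationals, where
-- it is a cross multiplication.
+-/1 : ∀ a b → + (a + b) / 1 ≡ (+ a / 1) ℚ.+ (+ b / 1)
+-/1 a b = ℚ.toℚᵘ-injective (begin
  ℚ.toℚᵘ (+ (a + b) / 1)  ≈⟨ ℚ.toℚᵘ-fromℚᵘ (ℚᵘ.mkℚᵘ (+ (a + b)) 0) ⟩
  ℚᵘ.mkℚᵘ (+ (a + b)) 0   ≈⟨ ℚᵘ.*≡* (cong (ℤ._* + 1) (≡-trans (ℤ.pos-+ a b)
                                                       (sym (cong₂ ℤ._+_ (ℤ.*-identityʳ (+ a)) (ℤ.*-identityʳ (+ b)))))) ⟩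
  ℚᵘ.mkℚᵘ (+ a) 0 ℚᵘ.+ ℚᵘ.mkℚᵘ (+ b) 0    ≈⟨ ℚᵘ.+-cong (ℚ.toℚᵘ-fromℚᵘ (ℚᵘ.mkℚᵘ (+ a) 0)) (ℚ.toℚᵘ-fromℚᵘ (ℚᵘ.mkℚᵘ (+ b) 0)) ⟨
  ℚ.toℚᵘ (+ a / 1) ℚᵘ.+ ℚ.toℚᵘ (+ b / 1)  ≈⟨ ℚ.toℚᵘ-homo-+ (+ a / 1) (+ b / 1) ⟨
  ℚ.toℚᵘ ((+ a / 1) ℚ.+ (+ b / 1))        ∎)
  where open ℚᵘ.≃-Reasoning

/-* : ∀ N m K L .{{_ : NonZero K}} .{{_ : NonZero L}} → N ℕ.* (L ℕ.* K) ≡ m →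
      + N / 1 ≡ (+ m / K) * (+ 1 / L)
/-* N m K@(suc k) L@(suc l) eq = ℚ.toℚᵘ-injective (begin
  ℚ.toℚᵘ (+ N / 1)                        ≈⟨ ℚ.toℚᵘ-fromℚᵘ (ℚᵘ.mkℚᵘ (+ N) 0) ⟩
  ℚᵘ.mkℚᵘ (+ N) 0                         ≈⟨ ℚᵘ.*≡* cross ⟩
  ℚᵘ.mkℚᵘ (+ m) k ℚᵘ.* ℚᵘ.mkℚᵘ (+ 1) l    ≈⟨ ℚᵘ.*-cong (ℚ.toℚᵘ-fromℚᵘ (ℚᵘ.mkℚᵘ (+ m) k)) (ℚ.toℚᵘ-fromℚᵘ (ℚᵘ.mkℚᵘ (+ 1) l)) ⟨
  ℚ.toℚᵘ (+ m / K) ℚᵘ.* ℚ.toℚᵘ (+ 1 / L)  ≈⟨ ℚ.toℚᵘ-homo-* (+ m / K) (+ 1 / L) ⟨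
  ℚ.toℚᵘ ((+ m / K) * (+ 1 / L))          ∎)
  where
  open ℚᵘ.≃-Reasoning
  cross : + N ℤ.* + (K ℕ.* L) ≡ + m ℤ.* + 1 ℤ.* + 1
  cross = ≡-trans (sym (ℤ.pos-* N (K ℕ.* L))) (≡-trans (cong (λ x → + x) (≡-trans (cong (N ℕ.*_) (ℕ.*-comm K L)) eq))
    (sym (≡-trans (ℤ.*-identityʳ (+ m ℤ.* + 1)) (ℤ.*-identityʳ (+ m)))))

∑ₗ-/1 : ∀ {p} (f : Fin p → ℕ) → + ∑ₗ (allFin p) f / 1 ≡ ∑[ i < p ] (+ f i / 1)
∑ₗ-/1 {zero}  f = refl
∑ₗ-/1 {suc p} f = ≡-trans (cong (λ s → + (f zero + s) / 1) (cong sum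
    (≡-trans (List.map-tabulate suc f) (sym (List.map-tabulate id (f ∘ suc))))))
  (≡-trans (+-/1 (f zero) _) (cong ((+ f zero / 1) ℚ.+_) (∑ₗ-/1 (f ∘ suc))))

-- Double counting of classes and arrangements

module _ {n p : ℕ} (π : HasCardinality (IntegerPartitions n) p) where

  open Inverse π using (inverseʳ; strictlyInverseˡ) renaming (to to partition; from to indexOf)

  sameType? : ∀ i (μ : PartitionedOrder n) → Dec (parts (partition i) ↭ parts (typeOf μ))
  sameType? i μ = parts (partition i) ↭? parts (typeOf μ)

  candidates : List (PartitionedOrder n)
  candidates = concatMap (arrangements ∘ partition) (allFin p)

  -- No representative is built by hand. Among the arrangements for the listed partition of the type
  -- of μ, the number equivalent to μ is a product of nonzero factors, so at least one exists.
  candidates-cover : ∀ μ → Any (μ ≡⋆_) candidates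
  candidates-cover μ = Any.concatMap⁺ (arrangements ∘ partition) (lose (∈.∈-allFin i)
    (Any.map (λ {ν} → ≡⋆-sym {μ = ν} {μ}) (∑ₗ-𝟙-any (_≡⋆? μ) (arrangements ρ)
      (subst (_≢ 0) (sym (class-size ρ μ (strictlyInverseˡ (typeOf μ)))) (≢-nonZero⁻¹ (lcmOfParts ρ ℕ.* ∏m!^j ρ))))))
    where
    i = indexOf (typeOf μ)
    ρ = partition i
    instance
      _ = ℕ.m*n≢0 (lcmOfParts ρ) (∏m!^j ρ) {{lcmOfParts≢0 ρ}} {{∏m!^j≢0 ρ}}

  BP⋆-decSetoid : DecSetoid _ _
  BP⋆-decSetoid = record
    { isDecEquivalence = record { isEquivalence = Setoid.isEquivalence (BP⋆ n) ; _≟_ = _≡⋆?_ } }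

  BP⋆-finite : ∃ (HasCardinality (BP⋆ n))
  BP⋆-finite = cover⇒cardinality BP⋆-decSetoid candidates candidates-cover

  module _ {c : ℕ} (classes : HasCardinality (BP⋆ n) c) where

    open Inverse classes using () renaming
      (to to representative; from to classOf; strictlyInverseˡ to representative-classOf; inverseʳ to classOf≡)

    classesOfType : Fin p → ℕ
    classesOfType i = ∑ₗ (allFin c) (λ k → 𝟙 (sameType? i (representative k)))

    one-type : ∀ μ → ∑ₗ (allFin p) (λ i → 𝟙 (sameType? i μ)) ≡ 1
    one-type μ = ∑ₗ-𝟙-unique (λ i → sameType? i μ)
      (λ {i} {j} i↭ j↭ → ≡-trans (sym (inverseʳ {i} {typeOf μ} (↭-sym i↭))) (inverseʳ {j} {typeOf μ} (↭-sym j↭)))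
      (yes (indexOf (typeOf μ) , strictlyInverseˡ (typeOf μ)))

    one-class : ∀ ν → ∑ₗ (allFin c) (λ k → 𝟙 (ν ≡⋆? representative k)) ≡ 1
    one-class ν = ∑ₗ-𝟙-unique (λ k → ν ≡⋆? representative k)
      (λ {k} {l} ν≡k ν≡l → ≡-trans (sym (classOf≡ {k} {ν} ν≡k)) (classOf≡ {l} {ν} ν≡l))
      (yes (classOf ν , ≡⋆-sym {μ = representative (classOf ν)} {ν} (representative-classOf ν)))

    ∑-classesOfType : ∑ₗ (allFin p) classesOfType ≡ c
    ∑-classesOfType = begin
      ∑ₗ (allFin p) classesOfType
        ≡⟨ ∑ₗ-comm _ (allFin p) (allFin c) ⟩
      ∑ₗ (allFin c) (λ k → ∑ₗ (allFin p) (λ i → 𝟙 (sameType? i (representative k))))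
        ≡⟨ ∑ₗ-cong (allFin c) (All.universal (λ k → one-type (representative k)) _) ⟩
      ∑ₗ (allFin c) (λ _ → 1)
        ≡⟨ ≡-trans (∑ₗ-1 (allFin c)) (List.length-tabulate {n = c} id) ⟩
      c ∎
      where open ≡-Reasoning

    -- Counts pairs of a class and an arrangement in it. Summed over arrangements, each pair count
    -- is 1 by `one-class`; summed over classes, `class-size-𝟙` applies.
    classesOfType-* : ∀ i → classesOfType i ℕ.* (lcmOfParts (partition i) ℕ.* ∏m!^j (partition i)) ≡ n !
    classesOfType-* i = begin
      classesOfType i ℕ.* (lcmOfParts ρ ℕ.* ∏m!^j ρ)
        ≡⟨ ∑ₗ-* _ _ (allFin c) ⟨
      ∑ₗ (allFin c) (λ k → 𝟙 (sameType? i (representative k)) ℕ.* (lcmOfParts ρ ℕ.* ∏m!^j ρ))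
        ≡⟨ ∑ₗ-cong (allFin c) (All.universal (λ k → class-size-𝟙 ρ (representative k) (sameType? i (representative k))) _) ⟨
      ∑ₗ (allFin c) (λ k → ∑ₗ (arrangements ρ) (λ ν → 𝟙 (ν ≡⋆? representative k)))
        ≡⟨ ∑ₗ-comm _ (allFin c) (arrangements ρ) ⟩
      ∑ₗ (arrangements ρ) (λ ν → ∑ₗ (allFin c) (λ k → 𝟙 (ν ≡⋆? representative k)))
        ≡⟨ ∑ₗ-cong (arrangements ρ) (All.universal one-class _) ⟩
      ∑ₗ (arrangements ρ) (λ _ → 1)
        ≡⟨ ∑ₗ-1 (arrangements ρ) ⟩
      List.length (arrangements ρ)
        ≡⟨ length-arrangements ρ ⟩
      n ! ∎
      where
      open ≡-Reasoning
      ρ = partition i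

theorem4 : (n : ℕ) → n ≥ 1 →
    (p : ℕ) (π : HasCardinality (IntegerPartitions n) p) →
    let open Inverse π using () renaming (to to partition) in
    ∃ λ c → HasCardinality (BP⋆ n) c ×
    + c / 1 ≡ ∑[ i < p ]
    ((+ (n !) / ∏m!^j (partition i)) {{∏m!^j≢0 (partition i)}}
    * (+ 1 / lcmOfParts (partition i)) {{lcmOfParts≢0 (partition i)}})
theorem4 n _ p π = c , classes , (begin
  + c / 1                                        ≡⟨ cong (λ m → + m / 1) (∑-classesOfType π classes) ⟨
  + ∑ₗ (allFin p) (classesOfType π classes) / 1  ≡⟨ ∑ₗ-/1 (classesOfType π classes) ⟩
  ∑[ i < p ] (+ classesOfType π classes i / 1)
    ≡⟨ sum-cong-≗ (λ i → /-* (classesOfType π classes i) (n !) (∏m!^j (partition i)) (lcmOfParts (partition i))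
         {{∏m!^j≢0 (partition i)}} {{lcmOfParts≢0 (partition i)}} (classesOfType-* π classes i)) ⟩
  ∑[ i < p ] ((+ (n !) / ∏m!^j (partition i)) {{∏m!^j≢0 (partition i)}}
    * (+ 1 / lcmOfParts (partition i)) {{lcmOfParts≢0 (partition i)}}) ∎)
  where
  open ≡-Reasoning
  open Inverse π using () renaming (to to partition)
  c = proj₁ (BP⋆-finite π)
  classes = proj₂ (BP⋆-finite π)
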